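{- Every finite simple $3$-connected non-bipartite graph $G$ with minimum degree at least four contains two cycles with consecutive odd lengths, i.e. there is an odd integer $\ell$ such that $G$ contains a cycle of length $\ell$ and a cycle of length $\ell+2$.
   Context: All graphs are finite, simple and undirected. The length of a cycle is its number of edges. -}

module Defs where

open import Data.Nat using (ℕ; zero; suc; _≤_; _+_; _*_)
open import Data.Bool using (Bool; true; false; T; not)
open import Data.Fin using (Fin; zero; suc; inject₁; fromℕ)
open import Data.Fin.Subset using (Subset; _∈_; _∉_; ∣_∣)
open import Data.List using (List; length; filterᵇ)
open import Data.Empty using (⊥)
open import Data.Product using (Σ; ∃; ∃-syntax; _×_; _,_)
open import Relation.Binary.PropositionalEquality using (_≡_; _≢_)
open import Relation.Nullary using (¬_)
open import Function.Definitions using (Injective)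
import Data.List as L

record Graph : Set where
  field
    n     : ℕ
    adj   : Fin n → Fin n → Bool
    sym   : ∀ u v → adj u v ≡ adj v u
    irref : ∀ v → adj v v ≡ false

open Graph public

Vertex : Graph → Set
Vertex G = Fin (n G)

Adj : (G : Graph) → Vertex G → Vertex G → Set
Adj G u v = T (adj G u v)

allVertices : (G : Graph) → List (Vertex G)
allVertices G = L.allFin (n G)

degree : (G : Graph) → Vertex G → ℕ
degree G v = length (filterᵇ (adj G v) (allVertices G))

MinDegreeAtLeast : ℕ → Graph → Set
MinDegreeAtLeast k G = ∀ v → k ≤ degree G v

Bipartite : Graph → Set
Bipartite G = Σ (Vertex G → Bool) λ c → ∀ u v → Adj G u v → c u ≢ c v

data WalkAvoiding (G : Graph) (X : Subset (n G)) : Vertex G → Vertex G → Set where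
  here : ∀ {v} → v ∉ X → WalkAvoiding G X v v
  step : ∀ {u w v} → u ∉ X → Adj G u w → WalkAvoiding G X w v → WalkAvoiding G X u v

ConnectedAfterRemoving : (G : Graph) → Subset (n G) → Set
ConnectedAfterRemoving G X = ∀ u v → u ∉ X → v ∉ X → WalkAvoiding G X u v

KConnected : ℕ → Graph → Set
KConnected k G = (suc k ≤ n G) × (∀ (X : Subset (n G)) → suc ∣ X ∣ ≤ k → ConnectedAfterRemoving G X)

HasCycle : Graph → ℕ → Set
HasCycle G zero = ⊥
HasCycle G (suc k) =
  (3 ≤ suc k) ×
  Σ (Fin (suc k) → Vertex G) λ f →
    Injective _≡_ _≡_ f ×
    (∀ (i : Fin k) → Adj G (f (inject₁ i)) (f (suc i))) ×
    Adj G (f (fromℕ k)) (f zero)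

{-# OPTIONS --safe #-}
module Submission where

-- The main step is that a disjoint pair of an odd cycle C and an even cycle D yields the two
-- cycles.  Take a connected set F ⊇ C that is maximal subject to V ∖ F containing an even cycle D.
-- A vertex with three neighbours in a connected set lies on an even cycle with vertices of that
-- set, and the degrees are at least four, so maximality gives V ∖ F = D, and every vertex of D has a
-- neighbour in F.  If u and v cut D into arcs whose lengths differ by two, and have neighbours x
-- and y that are joined to C by disjoint paths in F, then x and y are joined in F by paths of both
-- parities (along C), and we are done.  Not being joined to C by disjoint paths is an equivalence
-- relation on F, each class of which has at most one vertex with a neighbour in F outside the
-- class.  Otherwise, therefore, the neighbours of D in F belong to only two classes, and two
-- vertices separate D from C, against 3-connectedness.
--
-- Now let C be a shortest odd cycle and assume that no odd cycle is disjoint from an even one.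
-- Then G − C has no even cycle, so one of its vertices v has at most two neighbours off C, and
-- hence at least two on C.
-- If C is a triangle, then G − C − v is a forest, as C ∪ {v} contains a 4-cycle; at the end of a
-- longest path of this forest, or next to it, there are two vertices of G − C at distance at most
-- two that both have two neighbours on C, and this gives a 5-cycle.
-- If C is longer, then the neighbours c₁, c₃ of v on C have a common neighbour c₂ on C, and a path in
-- G − C from v to a neighbour of the vertex c₄ that follows c₃ closes up to the two cycles.

open import Defs
open import Data.Bool using (Bool; true; false; T; not; _xor_)
import Data.Bool.Properties as Boolₚ
open import Data.Empty using (⊥; ⊥-elim)
open import Data.Fin using (Fin; zero; suc; inject₁; fromℕ; toℕ; fromℕ<)
open import Data.Fin.Properties using (_≟_; injective⇒≤; any?; toℕ-fromℕ<)
import Data.Fin.Subset as Subset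
import Data.Fin.Subset.Properties as Subsetₚ
open import Data.List using (List; []; _∷_; _++_; length; lookup; filter; [_])
import Data.List.Membership.DecPropositional as DecMembership
open import Data.List.Membership.Propositional using (_∈_; _∉_)
open import Data.List.Membership.Propositional.Properties using (∈-++⁺ˡ; ∈-++⁺ʳ; ∈-++⁻; ∈-filter⁻; ∈-lookup; ∈-∃++)
open import Data.List.Properties using (length-++; ++-assoc; ++-identityʳ; ∷ʳ-injectiveʳ)
open import Data.List.Relation.Binary.Disjoint.Propositional using (Disjoint)
open import Data.List.Relation.Binary.Permutation.Propositional using (_↭_; prep; swap; ↭-refl; ↭-sym; ↭-trans; ↭-reflexive; ↭⇒↭ₛ)
open import Data.List.Relation.Binary.Permutation.Propositional.Properties using (∈-resp-↭; ↭-length; ↭-reverse; ++-comm; ∷↭∷ʳ; shift; ++⁺ˡ)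
import Data.List.Relation.Binary.Permutation.Setoid.Properties as ↭ₛ
open import Data.List.Relation.Binary.Subset.Propositional using (_⊆_)
open import Data.List.Relation.Unary.All using ([]; _∷_)
open import Data.List.Relation.Unary.All.Properties using (All¬⇒¬Any; ¬Any⇒All¬)
open import Data.List.Relation.Unary.AllPairs using ([]; _∷_)
open import Data.List.Relation.Unary.Any using (here; there)
import Data.List.Relation.Unary.Unique.DecPropositional as DecUnique
open import Data.List.Relation.Unary.Unique.Propositional using (Unique)
import Data.List.Relation.Unary.Unique.Propositional.Properties as Uniqueₚ
open import Data.Nat using (ℕ; zero; suc; _+_; _*_; _≤_; _<_; z≤n; s≤s)
open import Data.Nat.Properties using (≤-trans; ≤-refl; ≤-reflexive; ≤-pred; <-irrefl; <⇒≤; _≤?_; ≰⇒>; 1+n≰n; n≤1+n; suc-injective; +-suc; +-comm; +-assoc; m≤m+n; m≤n+m; +-monoʳ-≤; +-monoˡ-≤; +-cancelˡ-≤)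
open import Data.Product using (Σ; ∃; ∃-syntax; _×_; _,_; proj₁; proj₂)
open import Data.Sum using (_⊎_; inj₁; inj₂; [_,_]′)
open import Data.Unit using (⊤)
import Data.Vec as Vec
open import Function using (_∘_; id)
open import Relation.Binary.PropositionalEquality using (_≡_; _≢_; refl; trans; cong; cong₂; subst; setoid) renaming (sym to ≡-sym)
open import Relation.Nullary using (¬_; Dec; yes; no)
open import Relation.Nullary.Decidable using (¬¬-excluded-middle; ¬?; map′; _×-dec_; decidable-stable)
open import Relation.Nullary.Negation using (¬¬-map)

private
  variable
    A B : Set

-- The conclusion is decidable, so it may be proved under a double negation, where excluded middle
-- is available.
em : ¬ ¬ Dec A
em = ¬¬-excluded-middle

_>>=_ : ¬ ¬ A → (A → ¬ ¬ B) → ¬ ¬ B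
(m >>= f) k = m λ a → f a k

return : A → ¬ ¬ A
return a k = k a

run : ¬ ¬ ⊥ → ⊥
run m = m id

-- Parity of natural numbers.

odd? : ℕ → Bool
odd? zero    = false
odd? (suc k) = not (odd? k)

odd?-+ : ∀ j k → odd? (j + k) ≡ odd? j xor odd? k
odd?-+ zero    k = refl
odd?-+ (suc j) k with odd? j | odd? (j + k) | odd?-+ j k
... | true  | _ | refl with odd? k
... | true  = refl
... | false = refl
odd?-+ (suc j) k | false | _ | refl = refl

odd?-swap : ∀ i j k → odd? (i + (j + k)) ≡ odd? j xor odd? (i + k)
odd?-swap i j k = trans (cong odd? (trans (≡-sym (+-assoc i j k)) (trans (cong (_+ k) (+-comm i j)) (+-assoc j i k)))) (odd?-+ j (i + k))

odd?⇒≡1+2* : ∀ k → odd? k ≡ true → ∃[ j ] k ≡ 2 * j + 1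
odd?⇒≡1+2* (suc zero) _ = 0 , refl
odd?⇒≡1+2* (suc (suc k)) o with odd?⇒≡1+2* k (Boolₚ.not-injective (Boolₚ.not-injective o))
... | j , refl = suc j , cong suc (cong (_+ 1) (≡-sym (+-suc j (j + 0))))

odd?⇒≥1 : ∀ k → odd? k ≡ true → 1 ≤ k
odd?⇒≥1 (suc _) _ = s≤s z≤n

even⇒double : ∀ k → odd? k ≡ false → ∃[ j ] k ≡ j + j
even⇒double zero _ = 0 , refl
even⇒double (suc (suc k)) e with even⇒double k (Boolₚ.not-injective (Boolₚ.not-injective e))
... | j , refl = suc j , cong suc (≡-sym (+-suc j j))

xor-either : ∀ b {a a′} → a xor a′ ≡ true → a ≡ b ⊎ a′ ≡ b
xor-either true  {true}  {false} _ = inj₁ refl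
xor-either false {true}  {false} _ = inj₂ refl
xor-either true  {false} {true}  _ = inj₂ refl
xor-either false {false} {true}  _ = inj₁ refl

-- Lists without repetitions.

module _ {A : Set} where

  Unique-resp-↭ : {xs ys : List A} → xs ↭ ys → Unique xs → Unique ys
  Unique-resp-↭ p = ↭ₛ.Unique-resp-↭ (setoid A) (↭⇒↭ₛ p)

  unique-∉ : ∀ {x : A} {xs} → Unique (x ∷ xs) → x ∉ xs
  unique-∉ (a ∷ _) = All¬⇒¬Any a

  unique-tail : ∀ {x : A} {xs} → Unique (x ∷ xs) → Unique xs
  unique-tail (_ ∷ u) = u

  unique-∷ : ∀ {x : A} {xs} → x ∉ xs → Unique xs → Unique (x ∷ xs)
  unique-∷ x∉ u = ¬Any⇒All¬ _ x∉ ∷ u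

  unique-++ˡ : ∀ (xs : List A) {ys} → Unique (xs ++ ys) → Unique xs
  unique-++ˡ []       u = []
  unique-++ˡ (x ∷ xs) u = unique-∷ (λ x∈ → unique-∉ u (∈-++⁺ˡ x∈)) (unique-++ˡ xs (unique-tail u))

  unique-++ʳ : ∀ (xs : List A) {ys} → Unique (xs ++ ys) → Unique ys
  unique-++ʳ []       u = u
  unique-++ʳ (x ∷ xs) u = unique-++ʳ xs (unique-tail u)

  unique-++-disjoint : ∀ (xs : List A) {ys} → Unique (xs ++ ys) → Disjoint xs ys
  unique-++-disjoint (x ∷ xs) u (here refl , q) = unique-∉ u (∈-++⁺ʳ xs q)
  unique-++-disjoint (x ∷ xs) u (there p , q)   = unique-++-disjoint xs (unique-tail u) (p , q)

  lookup-injective : ∀ {xs : List A} → Unique xs → ∀ {i j} → lookup xs i ≡ lookup xs j → i ≡ j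
  lookup-injective {x ∷ xs} u {zero}  {zero}  eq = refl
  lookup-injective {x ∷ xs} u {zero}  {suc j} eq = ⊥-elim (unique-∉ u (subst (_∈ xs) (≡-sym eq) (∈-lookup j)))
  lookup-injective {x ∷ xs} u {suc i} {zero}  eq = ⊥-elim (unique-∉ u (subst (_∈ xs) eq (∈-lookup i)))
  lookup-injective {x ∷ xs} u {suc i} {suc j} eq = cong suc (lookup-injective (unique-tail u) eq)

head-or-tail : ∀ {v x : A} {xs} → v ∈ x ∷ xs → v ≡ x ⊎ v ∈ xs
head-or-tail (here q)  = inj₁ q
head-or-tail (there m) = inj₂ m

∈-insert : ∀ {v x y : A} {xs} → v ∈ x ∷ xs → v ∈ x ∷ y ∷ xs
∈-insert (here q)  = here q
∈-insert (there m) = there (there m)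

∈-remove : ∀ {v x y : A} {xs} → v ≢ y → v ∈ x ∷ y ∷ xs → v ∈ x ∷ xs
∈-remove v≢y (here q)          = here q
∈-remove v≢y (there (here q))  = ⊥-elim (v≢y q)
∈-remove v≢y (there (there m)) = there m

unique-length : ∀ {k} {xs : List (Fin k)} → Unique xs → length xs ≤ k
unique-length u = injective⇒≤ (lookup-injective u)

-- Counting by lists of distinct elements.

record Within {A : Set} (S : A → Set) (xs : List A) : Set where
  constructor within
  field
    at : ∀ {x} → x ∈ xs → S x

open Within

-- A lower bound on a cardinality, witnessed by distinct elements, so that `P` need not be
-- decidable.
AtLeast : ℕ → (A → Set) → Set
AtLeast {A} k P = ∃[ xs ] Unique {A = A} xs × k ≤ length xs × Within P xs

atLeast-map : ∀ {P Q : A → Set} {k} → (∀ {x} → P x → Q x) → AtLeast k P → AtLeast k Q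
atLeast-map f (xs , u , l , p) = xs , u , l , within (f ∘ at p)

filter-lengths : ∀ {Q : A → Set} (Q? : ∀ x → Dec (Q x)) xs →
                 length xs ≡ length (filter Q? xs) + length (filter (¬? ∘ Q?) xs)
filter-lengths Q? [] = refl
filter-lengths Q? (x ∷ xs) with Q? x
... | yes _ = cong suc (filter-lengths Q? xs)
... | no  _ = trans (cong suc (filter-lengths Q? xs)) (≡-sym (+-suc _ _))

-- Pigeonhole: at most `i` elements in `Q` and at most `j` outside account for only `i + j` of them.
atLeast-split : ∀ {P Q : A → Set} (i j : ℕ) → (∀ x → Dec (Q x)) → AtLeast (suc (i + j)) P →
                AtLeast (suc i) (λ x → P x × Q x) ⊎ AtLeast (suc j) (λ x → P x × ¬ Q x)
atLeast-split i j Q? (xs , u , l , p) with suc i ≤? length (filter Q? xs)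
... | yes l₁ = inj₁ (filter Q? xs , Uniqueₚ.filter⁺ Q? u , l₁ ,
        within λ m → let (m′ , q) = ∈-filter⁻ Q? {xs = xs} m in at p m′ , q)
... | no ¬l₁ = inj₂ (filter (¬? ∘ Q?) xs , Uniqueₚ.filter⁺ (¬? ∘ Q?) u ,
        +-cancelˡ-≤ i _ _ (≤-trans (≤-reflexive (+-suc i j)) (≤-trans l (≤-trans
          (≤-reflexive (filter-lengths Q? xs)) (+-monoˡ-≤ _ (≤-pred (≰⇒> ¬l₁)))))) ,
        within λ m → let (m′ , q) = ∈-filter⁻ (¬? ∘ Q?) {xs = xs} m in at p m′ , q)

atLeast-pred : ∀ {P : A → Set} {k} → AtLeast (suc k) P → AtLeast k P
atLeast-pred (xs , u , l , p) = xs , u , <⇒≤ l , p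

atLeast₁ : ∀ {P : A → Set} → AtLeast 1 P → ∃ P
atLeast₁ (a ∷ _ , _ , _ , p) = a , at p (here refl)

atLeast₂ : ∀ {P : A → Set} → AtLeast 2 P → ∃[ a ] ∃[ b ] a ≢ b × P a × P b
atLeast₂ (_ ∷ [] , _ , s≤s () , _)
atLeast₂ (a ∷ b ∷ _ , u , _ , p) = a , b , unique-∉ u ∘ here , at p (here refl) , at p (there (here refl))

atLeast₃ : ∀ {P : A → Set} → AtLeast 3 P →
           ∃[ a ] ∃[ b ] ∃[ c ] (a ≢ b × a ≢ c × b ≢ c) × P a × P b × P c
atLeast₃ (_ ∷ [] , _ , s≤s () , _)
atLeast₃ (_ ∷ _ ∷ [] , _ , s≤s (s≤s ()) , _)
atLeast₃ (a ∷ b ∷ c ∷ _ , u , _ , p) = a , b , c ,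
  (unique-∉ u ∘ here , unique-∉ u ∘ there ∘ here , unique-∉ (unique-tail u) ∘ here) ,
  at p (here refl) , at p (there (here refl)) , at p (there (there (here refl)))

-- Splitting by equality with `x`, the first alternative would give two distinct elements equal to
-- `x`.
atLeast-∉ : ∀ {k m} {P : Fin m → Set} (x : Fin m) → AtLeast (suc (suc k)) P → AtLeast (suc k) (λ y → P y × y ≢ x)
atLeast-∉ {k} x al with atLeast-split 1 k (_≟ x) al
... | inj₂ al′ = al′
... | inj₁ al′ with atLeast₂ al′
... | _ , _ , a≢b , (_ , refl) , (_ , refl) = ⊥-elim (a≢b refl)

unique-⊆-length : ∀ {A : Set} {xs ys : List A} → Unique xs → xs ⊆ ys → length xs ≤ length ys
unique-⊆-length {xs = []} _ _ = z≤n
unique-⊆-length {xs = x ∷ xs} u ⊆ys with ∈-∃++ (⊆ys (here refl))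
... | as , bs , refl = ≤-trans (s≤s (unique-⊆-length (unique-tail u) rest))
        (≤-reflexive (≡-sym (↭-length (shift x as bs))))
  where
    rest : xs ⊆ as ++ bs
    rest m with ∈-resp-↭ (shift x as bs) (⊆ys (there m))
    ... | here refl = ⊥-elim (unique-∉ u m)
    ... | there m′  = m′

∣p∪q∣≤∣p∣+∣q∣ : ∀ {k} (p q : Subset.Subset k) → Subset.∣ p Subset.∪ q ∣ ≤ Subset.∣ p ∣ + Subset.∣ q ∣
∣p∪q∣≤∣p∣+∣q∣ Vec.[] Vec.[] = z≤n
∣p∪q∣≤∣p∣+∣q∣ (false Vec.∷ p) (false Vec.∷ q) = ∣p∪q∣≤∣p∣+∣q∣ p q
∣p∪q∣≤∣p∣+∣q∣ (false Vec.∷ p) (true Vec.∷ q) = ≤-trans (s≤s (∣p∪q∣≤∣p∣+∣q∣ p q)) (≤-reflexive (≡-sym (+-suc _ _)))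
∣p∪q∣≤∣p∣+∣q∣ (true Vec.∷ p) (false Vec.∷ q) = s≤s (∣p∪q∣≤∣p∣+∣q∣ p q)
∣p∪q∣≤∣p∣+∣q∣ (true Vec.∷ p) (true Vec.∷ q) = s≤s (≤-trans (∣p∪q∣≤∣p∣+∣q∣ p q) (+-monoʳ-≤ _ (n≤1+n _)))

-- Walks, paths and cycles.

module Walks (G : Graph) where

  V : Set
  V = Vertex G

  private
    variable
      x y z p : V
      vs ws : List V

  _~_ : V → V → Set
  x ~ y = Adj G x y

  open DecMembership (_≟_ {n G}) using (_∈?_) public

  ~-sym : x ~ y → y ~ x
  ~-sym {x} {y} = subst T (sym G x y)

  ~-irrefl : ¬ x ~ x
  ~-irrefl {x} = subst T (irref G x)

  ~⇒≢ : x ~ y → x ≢ y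
  ~⇒≢ e refl = ~-irrefl e

  -- The list omits the last vertex, so its length is the number of edges.
  data Walk : V → V → List V → Set where
    nil  : Walk x x []
    _∷ʷ_ : x ~ y → Walk y z vs → Walk x z (x ∷ vs)

  infixr 5 _∷ʷ_ _++ʷ_

  _++ʷ_ : Walk x y vs → Walk y z ws → Walk x z (vs ++ ws)
  nil      ++ʷ w′ = w′
  (e ∷ʷ w) ++ʷ w′ = e ∷ʷ (w ++ʷ w′)

  start∈ : Walk x z vs → x ∈ z ∷ vs
  start∈ nil      = here refl
  start∈ (_ ∷ʷ _) = there (here refl)

  data SplitAt (y x z : V) : List V → Set where
    splitAt : ∀ as bs → Walk x y as → Walk y z (y ∷ bs) → SplitAt y x z (as ++ y ∷ bs)

  split∈ : Walk x z vs → y ∈ vs → SplitAt y x z vs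
  split∈ (e ∷ʷ w) (here refl) = splitAt [] _ nil (e ∷ʷ w)
  split∈ (e ∷ʷ w) (there m) with split∈ w m
  ... | splitAt as bs w₁ w₂ = splitAt (_ ∷ as) bs (e ∷ʷ w₁) w₂

  splitEnd : Walk x z vs → y ∈ z ∷ vs → ∃[ as ] ∃[ bs ] vs ≡ as ++ bs × Walk x y as × Walk y z bs
  splitEnd w (here refl) = _ , [] , ≡-sym (++-identityʳ _) , w , nil
  splitEnd w (there m) with split∈ w m
  ... | splitAt as bs w₁ w₂ = as , _ , refl , w₁ , w₂

  reverseʷ : Walk x y vs → ∃[ ws ] Walk y x ws × x ∷ ws ↭ y ∷ vs
  reverseʷ nil = [] , nil , ↭-refl
  reverseʷ {x} (_∷ʷ_ {y = y} e w) with reverseʷ w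
  ... | ws , w′ , σ = ws ++ [ y ] , w′ ++ʷ (~-sym e ∷ʷ nil) ,
    ↭-trans (prep x (↭-trans (↭-sym (∷↭∷ʳ y ws)) σ)) (swap x _ ↭-refl)

  -- The last vertex, which `Walk` omits, is put in front; vertex lists are compared up to
  -- permutation, so its place does not matter.
  Path : V → V → List V → Set
  Path x y vs = Walk x y vs × Unique (y ∷ vs)

  reverseᵖ : Path x y vs → ∃[ ws ] Path y x ws × x ∷ ws ↭ y ∷ vs
  reverseᵖ (w , u) with reverseʷ w
  ... | ws , w′ , σ = ws , (w′ , Unique-resp-↭ (↭-sym σ) u) , σ

  consᵖ : x ~ y → x ∉ z ∷ vs → Path y z vs → Path x z (x ∷ vs)
  consᵖ e x∉ (w , u) = e ∷ʷ w , Unique-resp-↭ (swap _ _ ↭-refl) (unique-∷ x∉ u)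

  splitᵖ : Path x z vs → y ∈ z ∷ vs →
           ∃[ as ] ∃[ bs ] vs ≡ as ++ bs × Path x y as × Path y z bs × Disjoint as (z ∷ bs)
  splitᵖ {z = z} (w , u) m with splitEnd w m
  ... | as , bs , refl , w₁ , w₂ = as , bs , refl ,
      (w₁ , unique-∷ (λ m → d (m , start∈ w₂)) (unique-++ˡ as (unique-tail u))) ,
      (w₂ , unique-∷ (unique-∉ u ∘ ∈-++⁺ʳ as) (unique-++ʳ as (unique-tail u))) , d
    where
      d : Disjoint as (z ∷ bs)
      d (m , here refl) = unique-∉ u (∈-++⁺ˡ m)
      d (m , there m′)  = unique-++-disjoint as (unique-tail u) (m , m′)

  snocᵖ : Path x y vs → y ~ z → z ∉ y ∷ vs → ∃[ ws ] Path x z ws × ws ↭ y ∷ vs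
  snocᵖ {y = y} {vs = vs} (w , u) e z∉ = vs ++ [ y ] , (w ++ʷ (e ∷ʷ nil) ,
    Unique-resp-↭ (prep _ (∷↭∷ʳ y vs)) (unique-∷ z∉ u)) , ↭-sym (∷↭∷ʳ y vs)

  _++ᵖ_ : Path x y vs → Path y z ws → Disjoint vs (z ∷ ws) → Path x z (vs ++ ws)
  _++ᵖ_ {vs = vs} {z} {ws} (w , u) (w′ , u′) d = w ++ʷ w′ ,
    Unique-resp-↭ (shift z vs ws) (Uniqueₚ.++⁺ (unique-tail u) u′ d)

  shorten : Walk x y vs → ∃[ ws ] Path x y ws × ws ⊆ vs
  shorten nil = [] , (nil , [] ∷ []) , id
  shorten {x} {z} (e ∷ʷ w) with shorten w
  ... | ws , P , ⊆vs with x ∈? z ∷ ws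
  ... | no x∉ = x ∷ ws , consᵖ e x∉ P , λ { (here q) → here q ; (there m) → there (⊆vs m) }
  ... | yes (here refl) = [] , (nil , [] ∷ []) , λ ()
  ... | yes (there m) with split∈ (proj₁ P) m
  ... | splitAt as bs _ w₂ = x ∷ bs , (w₂ , unique-∷ (unique-∉ (proj₂ P) ∘ ∈-++⁺ʳ as) (unique-++ʳ as (unique-tail (proj₂ P)))) ,
        λ m → there (⊆vs (∈-++⁺ʳ as m))

  -- The list of a closed walk contains the base point only once, so `Unique` expresses that no
  -- vertex is repeated. The length bound excludes an edge traversed back and forth.
  Cycle : List V → Set
  Cycle vs = ∃[ x ] Walk x x vs × Unique vs × 3 ≤ length vs

  -- The order of `xs` carries no information; only its elements and its length matter.
  CycleOn : List V → Set
  CycleOn xs = ∃[ vs ] Cycle vs × vs ↭ xs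

  cycle-at : Cycle vs → y ∈ vs → ∃[ ws ] Walk y y (y ∷ ws) × y ∷ ws ↭ vs
  cycle-at (x , w , _ , _) m with split∈ w m
  ... | splitAt as bs w₁ w₂ = bs ++ as , w₂ ++ʷ w₁ , ++-comm (_ ∷ bs) as

  close : Path x y vs → Path y x ws → Disjoint vs ws → 3 ≤ length (vs ++ ws) → Cycle (vs ++ ws)
  close (w , u) (w′ , u′) d l = _ , w ++ʷ w′ , Uniqueₚ.++⁺ (unique-tail u) (unique-tail u′) d , l

  -- The vertex `x` closes a path between two of its neighbours; distinct ends guarantee three
  -- vertices.
  apex : x ~ y → z ~ x → y ≢ z → Path y z vs → x ∉ z ∷ vs → CycleOn (x ∷ z ∷ vs)
  apex {z = z} e f y≢z (nil , u) x∉ = ⊥-elim (y≢z refl)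
  apex {x = x} {z = z} e f y≢z (w@(_∷ʷ_ {vs = vs} _ _) , u) x∉ = _ ,
    (x , e ∷ʷ (w ++ʷ (f ∷ʷ nil)) , Unique-resp-↭ (prep x (∷↭∷ʳ z _)) (unique-∷ x∉ u) , s≤s (s≤s (two vs))) ,
    ↭-sym (prep x (∷↭∷ʳ z _))
    where
      two : ∀ (us : List V) → 1 ≤ length (us ++ [ z ])
      two []       = s≤s z≤n
      two (_ ∷ us) = s≤s z≤n

  cycle⇒HasCycle : Cycle vs → HasCycle G (length vs)
  cycle⇒HasCycle {x ∷ vs} (_ , w@(_ ∷ʷ _) , u , l) = l , lookup (x ∷ vs) , lookup-injective u , steps w , last w
    where
      steps : ∀ {y z v vs} → Walk y z (v ∷ vs) → ∀ i → lookup (v ∷ vs) (inject₁ i) ~ lookup vs i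
      steps (e ∷ʷ (_ ∷ʷ _)) zero = e
      steps (_ ∷ʷ w@(_ ∷ʷ _)) (suc i) = steps w i
      last : ∀ {y z v vs} → Walk y z (v ∷ vs) → lookup (v ∷ vs) (fromℕ (length vs)) ~ z
      last (e ∷ʷ nil) = e
      last (_ ∷ʷ w@(_ ∷ʷ _)) = last w

  EvenCycleIn OddCycleIn : (V → Set) → Set
  EvenCycleIn S = ∃[ vs ] Cycle vs × odd? (length vs) ≡ false × Within S vs
  OddCycleIn  S = ∃[ vs ] Cycle vs × odd? (length vs) ≡ true × Within S vs

  evenCycle-map : ∀ {S S′ : V → Set} → (∀ {x} → S x → S′ x) → EvenCycleIn S → EvenCycleIn S′
  evenCycle-map f (vs , c , o , i) = vs , c , o , within (f ∘ at i)

  Connected : (V → Set) → Set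
  Connected S = ∀ {x y} → S x → S y → ∃[ vs ] Walk x y vs × Within S vs

  firstHit : ∀ {xs} → Walk x y vs → y ∈ xs →
             ∃[ p ] ∃[ ws ] Walk x p ws × p ∈ xs × Disjoint ws xs × ws ⊆ vs × (Unique vs → Unique ws)
  firstHit {x} {xs = xs} w y∈ with x ∈? xs
  firstHit w y∈ | yes x∈ = _ , [] , nil , x∈ , (λ ()) , (λ ()) , λ _ → []
  firstHit nil y∈ | no x∉ = ⊥-elim (x∉ y∈)
  firstHit (e ∷ʷ w) y∈ | no x∉ with firstHit w y∈
  ... | p , ws , w′ , p∈ , d , ⊆vs , u = p , _ ∷ ws , e ∷ʷ w′ , p∈ ,
    (λ { (here refl , m) → x∉ m ; (there m , m′) → d (m , m′) }) ,
    (λ { (here q) → here q ; (there m) → there (⊆vs m) }) ,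
    λ u′ → unique-∷ (unique-∉ u′ ∘ ⊆vs) (u (unique-tail u′))

  joinLegs : Path x p vs → Path y p ws → Disjoint vs ws → ∃[ us ] Path x y us × y ∷ us ↭ p ∷ vs ++ ws
  joinLegs {p = p} {vs} {y} {ws} P Q d with reverseᵖ Q
  ... | ws′ , Q′ , σ = vs ++ ws′ , (P ++ᵖ Q′) d′ ,
    ↭-trans (↭-sym (shift y vs ws′)) (↭-trans (++⁺ˡ vs σ) (shift p vs ws))
    where
      d′ : Disjoint vs (y ∷ ws′)
      d′ (m , m′) with ∈-resp-↭ σ m′
      ... | here refl = unique-∉ (proj₂ P) m
      ... | there m″  = d (m , m″)

  -- Tripods and even cycles in theta graphs.

  module _ {S : V → Set} (conn : Connected S) where

    Leg : V → V → List V → Set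
    Leg x p vs = Path x p vs × Within S vs

    -- Take a path from `a` to `b`, and follow a path from `c` until it first hits that path, in
    -- `p`. The three legs are this piece and the two pieces into which `p` cuts the path from `a`
    -- to `b`.
    tripod : ∀ {a b c} → S a → S b → S c →
             ∃[ p ] ∃[ as ] ∃[ bs ] ∃[ cs ] S p × (Leg a p as × Leg b p bs × Leg c p cs) ×
               (Disjoint as bs × Disjoint as cs × Disjoint bs cs)
    tripod {a} {b} {c} sa sb sc with conn sa sb | conn sc sb
    ... | _ , w₁ , in₁ | _ , w₂ , in₂ with shorten w₁ | shorten w₂
    ... | ps , P , ⊆₁ | qs , (Q , uQ) , ⊆₂ with firstHit {xs = b ∷ ps} Q (here refl)
    ... | p , cs , C , p∈ , d , ⊆qs , u with splitᵖ P p∈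
    ... | as , bs′ , refl , A , B′ , das with reverseᵖ B′
    ... | bs , B , σ =
      p , as , bs , cs , inS p∈ ,
      ((A , within (inS ∘ there ∘ ∈-++⁺ˡ)) , (B , within (inS ∘ ⊆b)) ,
       ((C , unique-∷ (λ m → d (m , p∈)) (u (unique-tail uQ))) , within (at in₂ ∘ ⊆₂ ∘ ⊆qs))) ,
      ((λ { (m , m′) → das (m , ∈-resp-↭ σ (there m′)) }) ,
       (λ { (m , m′) → d (m′ , there (∈-++⁺ˡ m)) }) ,
       (λ { (m , m′) → d (m′ , ⊆b m) }))
      where
        inS : ∀ {x} → x ∈ b ∷ as ++ bs′ → S x
        inS (here refl) = sb
        inS (there m)   = at in₁ (⊆₁ m)
        ⊆b : bs ⊆ b ∷ as ++ bs′
        ⊆b m with ∈-resp-↭ σ (there m)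
        ... | here q   = here q
        ... | there m′ = there (∈-++⁺ʳ as m′)

    -- Of the three cycles through v and two of its neighbours, along the legs of a tripod, one is even.
    theta : ∀ {v a b c} → ¬ S v → S a → S b → S c → a ≢ b → a ≢ c → b ≢ c → v ~ a → v ~ b → v ~ c →
            EvenCycleIn (λ x → x ≡ v ⊎ S x)
    theta {v} v∉ sa sb sc a≢b a≢c b≢c va vb vc with tripod sa sb sc
    ... | p , as , bs , cs , sp , (A , B , C) , dab , dac , dbc = pick (length as) (length bs) (length cs)
            (cyc A B dab a≢b va vb) (cyc A C dac a≢c va vc) (cyc B C dbc b≢c vb vc)
      where
        cyc : ∀ {x y xs ys} → Leg x p xs → Leg y p ys → Disjoint xs ys → x ≢ y → v ~ x → v ~ y →
              ∃[ us ] Cycle us × length us ≡ 2 + (length xs + length ys) × Within (λ x → x ≡ v ⊎ S x) us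
        cyc {xs = xs} {ys} (P , inP) (Q , inQ) d x≢y vx vy with joinLegs P Q d
        ... | us , R , σ = let (cs , cy , τ) = apex vx (~-sym vy) x≢y R (λ m → v∉ (inS (∈-resp-↭ σ m))) in
          cs , cy , trans (↭-length τ) (cong suc (trans (↭-length σ) (cong suc (length-++ xs)))) ,
          within λ m → inS′ (∈-resp-↭ τ m)
          where
            inS : ∀ {x} → x ∈ p ∷ xs ++ ys → S x
            inS (here refl) = sp
            inS (there m) with ∈-++⁻ xs m
            ... | inj₁ m′ = at inP m′
            ... | inj₂ m′ = at inQ m′
            inS′ : ∀ {u} → u ∈ v ∷ _ ∷ us → u ≡ v ⊎ S u
            inS′ (here q)  = inj₁ q
            inS′ (there m) = inj₂ (inS (∈-resp-↭ σ m))
        Cyc : ℕ → Set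
        Cyc l = ∃[ us ] Cycle us × length us ≡ 2 + l × Within (λ x → x ≡ v ⊎ S x) us
        even : ∀ j k → odd? j ≡ odd? k → Cyc (j + k) → EvenCycleIn (λ x → x ≡ v ⊎ S x)
        even j k eq (us , cy , l , inS) = us , cy , trans (cong odd? l) (lem (odd? j) (odd? k) (odd? (j + k)) eq (odd?-+ j k)) , inS
          where
            lem : ∀ a b c → a ≡ b → c ≡ a xor b → not (not c) ≡ false
            lem true  _ _ refl refl = refl
            lem false _ _ refl refl = refl
        -- Two of the three legs have lengths of equal parity, and the cycle along them has length
        -- two plus the sum of these lengths.
        pick : ∀ i j k → Cyc (i + j) → Cyc (i + k) → Cyc (j + k) → EvenCycleIn (λ x → x ≡ v ⊎ S x)
        pick i j k c₁ c₂ c₃ with odd? i in e₁ | odd? j in e₂ | odd? k in e₃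
        ... | true  | true  | _     = even i j (trans e₁ (≡-sym e₂)) c₁
        ... | false | false | _     = even i j (trans e₁ (≡-sym e₂)) c₁
        ... | true  | false | true  = even i k (trans e₁ (≡-sym e₃)) c₂
        ... | false | true  | false = even i k (trans e₁ (≡-sym e₃)) c₂
        ... | true  | false | false = even j k (trans e₂ (≡-sym e₃)) c₃
        ... | false | true  | true  = even j k (trans e₂ (≡-sym e₃)) c₃

    theta-atLeast : ∀ {v} → ¬ S v → AtLeast 3 (λ x → v ~ x × S x) → EvenCycleIn (λ x → x ≡ v ⊎ S x)
    theta-atLeast v∉ al with atLeast₃ al
    ... | a , b , c , (a≢b , a≢c , b≢c) , (va , sa) , (vb , sb) , (vc , sc) = theta v∉ sa sb sc a≢b a≢c b≢c va vb vc

  -- Connected vertex sets.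

  connectedFrom : ∀ {S : V → Set} {r} → (∀ {y} → S y → ∃[ vs ] Walk r y vs × Within S vs) → Connected S
  connectedFrom from sx sy with from sx | from sy
  ... | vs , w , i | ws , w′ , i′ with reverseʷ w
  ... | us , w″ , σ = us ++ ws , w″ ++ʷ w′ , within λ m → [ (λ m′ → in″ (∈-resp-↭ σ (there m′))) , at i′ ]′ (∈-++⁻ us m)
    where
      in″ : ∀ {v} → v ∈ _ ∷ vs → _
      in″ (here refl) = sx
      in″ (there m)   = at i m

  walkConnected : Walk x z vs → Connected (_∈ vs)
  walkConnected w = connectedFrom (from w)
    where
      from : ∀ {x z y vs} → Walk x z vs → y ∈ vs → ∃[ ws ] Walk x y ws × Within (_∈ vs) ws
      from w m with split∈ w m
      ... | splitAt as _ w₁ _ = as , w₁ , within ∈-++⁺ˡ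

  walkConnected′ : Walk x z vs → Connected (_∈ z ∷ vs)
  walkConnected′ {z = z} w = connectedFrom (from w)
    where
      from : ∀ {x y vs} → Walk x z vs → y ∈ z ∷ vs → ∃[ ws ] Walk x y ws × Within (_∈ z ∷ vs) ws
      from w m with splitEnd w m
      ... | as , _ , refl , w₁ , _ = as , w₁ , within (there ∘ ∈-++⁺ˡ)

  -- Odd closed walks and bipartiteness.

  walk-dup : Walk x z vs → Unique vs ⊎
    ∃[ y ] ∃[ as ] ∃[ bs ] ∃[ cs ] Walk x y as × Walk y y (y ∷ bs) × Walk y z (y ∷ cs) ×
      length vs ≡ length as + (suc (length bs) + suc (length cs))
  walk-dup nil = inj₁ []
  walk-dup {x} (_∷ʷ_ {vs = vs} e w) with x ∈? vs
  ... | no x∉ with walk-dup w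
  ...   | inj₁ u = inj₁ (unique-∷ x∉ u)
  ...   | inj₂ (y , as , bs , cs , w₁ , w₂ , w₃ , l) = inj₂ (y , x ∷ as , bs , cs , e ∷ʷ w₁ , w₂ , w₃ , cong suc l)
  walk-dup {x} (e ∷ʷ w) | yes m with split∈ w m
  ... | splitAt as bs w₁ w₂ = inj₂ (x , [] , as , bs , nil , e ∷ʷ w₁ , w₂ , cong suc (length-++ as))

  -- A repeated vertex cuts the walk into two closed walks, both shorter, since the last two pieces
  -- given by `walk-dup` are nonempty. One of the two has odd length. The recursion is on the bound
  -- `k` for the length.
  oddClosedWalk⇒oddCycle : ∀ k → length vs ≤ k → Walk x x vs → odd? (length vs) ≡ true → OddCycleIn (λ _ → ⊤)
  oddClosedWalk⇒oddCycle k l w o with walk-dup w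
  oddClosedWalk⇒oddCycle {x ∷ []} k l (e ∷ʷ nil) o | inj₁ u = ⊥-elim (~-irrefl e)
  oddClosedWalk⇒oddCycle {x ∷ y ∷ z ∷ vs} k l w o | inj₁ u = _ , (_ , w , u , s≤s (s≤s (s≤s z≤n))) , o , within _
  oddClosedWalk⇒oddCycle zero l w o | inj₂ (y , as , bs , cs , w₁ , w₂ , w₃ , eq)
    with () ← subst (_≤ 0) (trans eq (+-suc (length as) _)) l
  oddClosedWalk⇒oddCycle {vs} (suc k) l w o | inj₂ (y , as , bs , cs , w₁ , w₂ , w₃ , eq)
    with odd? (suc (length bs)) in ob
  ... | true  = oddClosedWalk⇒oddCycle k (≤-trans (≤-trans (m≤m+n _ (length cs)) (m≤n+m _ (length as))) l′) w₂ ob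
    where
      l′ : length as + (suc (length bs) + length cs) ≤ k
      l′ = ≤-pred (subst (_≤ suc k) (trans eq (trans (cong (length as +_) (+-suc (suc (length bs)) (length cs))) (+-suc (length as) _))) l)
  ... | false = oddClosedWalk⇒oddCycle {vs = as ++ y ∷ cs} k (subst (_≤ k) (≡-sym (length-++ as)) l′) (w₁ ++ʷ w₃)
                  (trans (cong odd? (length-++ as)) o′)
    where
      l′ : length as + suc (length cs) ≤ k
      l′ = ≤-pred (≤-trans (s≤s (+-monoʳ-≤ (length as) (m≤n+m _ (length bs))))
             (subst (_≤ suc k) (trans eq (+-suc (length as) _)) l))
      o′ : odd? (length as + suc (length cs)) ≡ true
      o′ = trans (≡-sym (cong (_xor odd? (length as + suc (length cs))) ob))
             (trans (≡-sym (odd?-swap (length as) (suc (length bs)) _)) (trans (cong odd? (≡-sym eq)) o))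

  avoid : KConnected 3 G → ∀ X → suc Subset.∣ X ∣ ≤ 3 → x Subset.∉ X → y Subset.∉ X →
          ∃[ vs ] Walk x y vs × Within (Subset._∉ X) (y ∷ vs)
  avoid (_ , conn) X small x∉ y∉ = go (conn X small _ _ x∉ y∉)
    where
      go : ∀ {x y} → WalkAvoiding G X x y → ∃[ vs ] Walk x y vs × Within (Subset._∉ X) (y ∷ vs)
      go (here y∉)      = [] , nil , within λ { (here refl) → y∉ }
      go (step x∉ e w) with go w
      ... | vs , w′ , i = _ , e ∷ʷ w′ , within λ { (here refl) → at i (here refl) ; (there (here refl)) → x∉ ; (there (there m)) → at i (there m) }

  connected : KConnected 3 G → ∀ x y → ∃[ vs ] Walk x y vs
  connected κ x y = let (vs , w , _) = avoid κ Subset.⊥ small Subsetₚ.∉⊥ Subsetₚ.∉⊥ in vs , w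
    where
      small : suc Subset.∣ Subset.⊥ {n = n G} ∣ ≤ 3
      small = subst (λ c → suc c ≤ 3) (≡-sym (Subsetₚ.∣⊥∣≡0 (n G))) (s≤s z≤n)

  -- Colour each vertex by the parity of a chosen walk from a root. An edge with ends of equal
  -- colour closes an odd walk, so without odd cycles the colouring is proper.
  ¬bipartite⇒oddCycle : KConnected 3 G → ¬ Bipartite G → ¬ ¬ OddCycleIn (λ _ → ⊤)
  ¬bipartite⇒oddCycle κ ¬bip k = ¬bip (colour , proper)
    where
      r : V
      r = fromℕ< (≤-trans (s≤s z≤n) (proj₁ κ))
      walkTo : ∀ v → ∃[ vs ] Walk r v vs
      walkTo = connected κ r
      colour : V → Bool
      colour v = odd? (length (proj₁ (walkTo v)))
      clash : ∀ {u v us vs} → Walk r u us → Walk r v vs → u ~ v → odd? (length us) ≢ odd? (length vs)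
      clash {us = us} wu wv e eq with reverseʷ wv
      ... | vs′ , wv′ , σ = k (oddClosedWalk⇒oddCycle _ ≤-refl (wu ++ʷ (e ∷ʷ wv′))
              (trans (cong odd? (length-++ us)) (trans (odd?-+ (length us) _)
                (lem (trans eq (≡-sym (cong odd? (suc-injective (↭-length σ)))))))))
        where
          lem : ∀ {a b} → a ≡ b → a xor not b ≡ true
          lem {true}  refl = refl
          lem {false} refl = refl
      proper : ∀ u v → u ~ v → colour u ≢ colour v
      proper u v = clash (proj₂ (walkTo u)) (proj₂ (walkTo v))

  -- Longest paths and degree conditions.

  LongestIn : (V → Set) → V → V → List V → Set
  LongestIn K x z vs = Path x z vs × Within K (z ∷ vs) ×
    (∀ x′ z′ vs′ → Path x′ z′ vs′ → Within K (z′ ∷ vs′) → length vs′ ≤ length vs)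

  -- A path has at most `n G` vertices, so it can be replaced by a longer one only finitely often;
  -- `k` bounds how often.
  longest : ∀ {K} → K x → ¬ ¬ (∃[ x ] ∃[ z ] ∃[ vs ] LongestIn K x z vs)
  longest {K = K} kx = go (n G) (nil , [] ∷ []) (within λ { (here refl) → kx }) (m≤m+n (n G) 0)
    where
      go : ∀ {x z vs} k → Path x z vs → Within K (z ∷ vs) → n G ≤ k + length vs → ¬ ¬ (∃[ x ] ∃[ z ] ∃[ vs ] LongestIn K x z vs)
      go zero P _ l = ⊥-elim (1+n≰n (≤-trans (unique-length (proj₂ P)) l))
      go {vs = vs} (suc k) P i l = do
        yes (x′ , z′ , vs′ , P′ , i′ , l′) ← em {A = ∃[ x′ ] ∃[ z′ ] ∃[ vs′ ] Longer vs x′ z′ vs′}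
          where no ¬longer → return (_ , _ , vs , P , i , maximal ¬longer)
        go k P′ i′ (≤-trans l (≤-trans (≤-reflexive (≡-sym (+-suc k _))) (+-monoʳ-≤ k l′)))
        where
          Longer : List V → V → V → List V → Set
          Longer vs x′ z′ vs′ = Path x′ z′ vs′ × Within K (z′ ∷ vs′) × length vs < length vs′
          maximal : ¬ (∃[ x′ ] ∃[ z′ ] ∃[ vs′ ] Longer vs x′ z′ vs′) →
                    ∀ x′ z′ vs′ → Path x′ z′ vs′ → Within K (z′ ∷ vs′) → length vs′ ≤ length vs
          maximal ¬longer _ _ _ P′ i′ = ≤-pred (≰⇒> λ l′ → ¬longer (_ , _ , _ , P′ , i′ , l′))

  -- Otherwise `y` could be put in front of the path.
  longest-closed : ∀ {K} → LongestIn K x z vs → x ~ y → K y → y ∈ z ∷ vs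
  longest-closed {z = z} {vs} {y} (P , i , max) e ky with y ∈? z ∷ vs
  ... | yes m = m
  ... | no y∉ = ⊥-elim (1+n≰n (max _ _ _ (consᵖ (~-sym e) y∉ P) (within λ { (here q) → at i (here q) ; (there (here refl)) → ky ; (there (there m)) → at i (there m) })))

  -- Some neighbour `y` of `x` on the path is not the second vertex `y₁`; the piece from `y₁` to `y`
  -- closes up through `x`.
  backCycle : Path x z vs → AtLeast 2 (λ y → x ~ y × y ∈ z ∷ vs) → ∃[ ws ] Cycle ws × ws ⊆ z ∷ vs
  backCycle (nil , u) al with atLeast₁ (atLeast-pred al)
  ... | _ , e , here refl = ⊥-elim (~-irrefl e)
  backCycle {x} {z} (_∷ʷ_ {y = y₁} {vs = us} e w , u) al with atLeast₁ (atLeast-∉ y₁ al)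
  ... | y , (e′ , m) , y≢y₁ with Unique-resp-↭ (swap z x ↭-refl) u
  ... | u′ with splitᵖ (w , unique-tail u′) (∈-remove (~⇒≢ e′ ∘ ≡-sym) m)
  ... | as , bs , refl , P , (Q , _) , _ with apex e (~-sym e′) (y≢y₁ ∘ ≡-sym) P x∉
    where
      ⊆us : y ∷ as ⊆ z ∷ as ++ bs
      ⊆us (here refl) with start∈ Q
      ... | here q  = here q
      ... | there m = there (∈-++⁺ʳ as m)
      ⊆us (there m) = there (∈-++⁺ˡ m)
      x∉ : x ∉ y ∷ as
      x∉ m = unique-∉ u′ (⊆us m)
  ... | ws , c , σ = ws , c , λ m′ → ⊆zx (∈-resp-↭ σ m′)
    where
      ⊆zx : x ∷ y ∷ as ⊆ z ∷ x ∷ as ++ bs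
      ⊆zx (here q)            = there (here q)
      ⊆zx (there (here refl)) = m
      ⊆zx (there (there m′))  = there (there (∈-++⁺ˡ m′))

  -- All neighbours in `K` of the first vertex of a longest path lie on that path.
  minDegree2⇒cycle : ∀ {K} → (∀ {v} → K v → AtLeast 2 (λ x → v ~ x × K x)) → K x →
                     ¬ ¬ (∃[ ws ] Cycle ws × Within K ws)
  minDegree2⇒cycle deg kx = do
    x , z , vs , L@(P , i , _) ← longest kx
    let ws , c , ⊆P = backCycle P (atLeast-map (λ { (e , k) → e , longest-closed L e k }) (deg (at i (start∈ (proj₁ P)))))
    return (ws , c , within (at i ∘ ⊆P))

  -- A longest path without its first vertex is a connected set containing three neighbours of that
  -- vertex, so `theta` applies.
  minDegree3⇒evenCycle : ∀ {K} → (∀ {v} → K v → AtLeast 3 (λ x → v ~ x × K x)) → K x → ¬ ¬ EvenCycleIn K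
  minDegree3⇒evenCycle {K = K} deg kx = do
    x , z , vs , L@(P , i , _) ← longest kx
    return (go P i (atLeast-map (λ { (e , k) → e , longest-closed L e k }) (deg (at i (start∈ (proj₁ P))))))
    where
      go : ∀ {x z vs} → Path x z vs → Within K (z ∷ vs) → AtLeast 3 (λ y → x ~ y × y ∈ z ∷ vs) → EvenCycleIn K
      go (nil , u) i al with atLeast₁ (atLeast-pred (atLeast-pred al))
      ... | _ , e , here refl = ⊥-elim (~-irrefl e)
      go {x} {z} (_∷ʷ_ {vs = us} e w , u) i al =
        evenCycle-map inK (theta-atLeast {S = _∈ z ∷ us} (walkConnected′ w) (unique-∉ (Unique-resp-↭ (swap z x ↭-refl) u))
          (atLeast-map (λ { (e , m) → e , ∈-remove (~⇒≢ e ∘ ≡-sym) m }) al))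
        where
          inK : ∀ {y} → y ≡ x ⊎ y ∈ z ∷ us → K y
          inK (inj₁ refl)      = at i (there (here refl))
          inK (inj₂ (here q))  = at i (here q)
          inK (inj₂ (there m)) = at i (there (there m))

  exits : ∀ {I : V → Set} {x y vs} → Walk x y vs → I x → ¬ I y →
          ¬ ¬ (∃[ u ] ∃[ v ] u ~ v × u ∈ vs × v ∈ y ∷ vs × I u × ¬ I v)
  exits nil ix ¬iy = ⊥-elim (¬iy ix)
  exits {I} (_∷ʷ_ {x} {y} e w) ix ¬iz = do
    yes iy ← em {A = I y}
      where no ¬iy → return (x , y , e , here refl , ∈-insert (start∈ w) , ix , ¬iy)
    (u , v , e′ , m , m′ , iu , ¬iv) ← exits w iy ¬iz
    return (u , v , e′ , there m , ∈-insert m′ , iu , ¬iv)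

  cycle-vertex : ∀ {vs} → Cycle vs → ∃[ v ] v ∈ vs
  cycle-vertex {v ∷ _} _ = v , here refl
  cycle-vertex {[]} (_ , _ , _ , ())

  stable-∈ : ∀ {x : V} {xs} → ¬ (x ∉ xs) → x ∈ xs
  stable-∈ {x} {xs} = decidable-stable (x ∈? xs)

  connected-∷ : ∀ {x y S} → x ~ y → y ∈ S → Connected (_∈ S) → Connected (_∈ x ∷ S)
  connected-∷ {x} {y} {S} e y∈ conn = connectedFrom from
    where
      from : ∀ {z} → z ∈ x ∷ S → ∃[ vs ] Walk x z vs × Within (_∈ x ∷ S) vs
      from (here refl) = [] , nil , within λ ()
      from (there m) = let (vs , w , i) = conn y∈ m in
        x ∷ vs , e ∷ʷ w , within λ { (here q) → here q ; (there m) → there (at i m) }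

  -- Cutting cycles into arcs.

  walk-take : ∀ {x y vs} i j → Walk x y vs → length vs ≡ i + j →
              ∃[ z ] ∃[ as ] ∃[ bs ] vs ≡ as ++ bs × length as ≡ i × length bs ≡ j × Walk x z as × Walk z y bs
  walk-take zero    j w        l = _ , [] , _ , refl , refl , l , nil , w
  walk-take (suc i) j (e ∷ʷ w) l with walk-take i j w (suc-injective l)
  ... | z , as , bs , refl , la , lb , w₁ , w₂ = z , _ ∷ as , bs , refl , cong suc la , lb , e ∷ʷ w₁ , w₂

  cycle-split : ∀ {cs c c′} → Cycle cs → c ∈ cs → c′ ∈ cs → c ≢ c′ →
                ∃[ as ] ∃[ bs ] Walk c c′ (c ∷ as) × Walk c′ c (c′ ∷ bs) × (c ∷ as) ++ c′ ∷ bs ↭ cs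
  cycle-split C c∈ c′∈ c≢c′ with cycle-at C c∈
  ... | rest , e ∷ʷ w , σ with ∈-resp-↭ (↭-sym σ) c′∈
  ... | here q = ⊥-elim (c≢c′ (≡-sym q))
  ... | there m with split∈ w m
  ... | splitAt as bs w₁ w₂ = as , bs , e ∷ʷ w₁ , w₂ , σ

  -- The lengths of the two arcs add up to an odd number, so exactly one of them has the parity `b`.
  arcs : ∀ {cs c c′} → Cycle cs → odd? (length cs) ≡ true → c ∈ cs → c′ ∈ cs → c ≢ c′ →
         ∀ b → ∃[ vs ] Path c c′ vs × Within (_∈ cs) (c′ ∷ vs) × odd? (length vs) ≡ b
  arcs {cs} {c} {c′} C o c∈ c′∈ c≢c′ b with cycle-split C c∈ c′∈ c≢c′
  ... | as , bs , w₁ , w₂ , σ = choose (reverseᵖ (w₂ , u₂))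
    where
      uniq : Unique ((c ∷ as) ++ c′ ∷ bs)
      uniq = Unique-resp-↭ (↭-sym σ) (proj₁ (proj₂ (proj₂ C)))
      u₁ : Unique (c′ ∷ c ∷ as)
      u₁ = unique-∷ (λ m → unique-++-disjoint (c ∷ as) uniq (m , here refl)) (unique-++ˡ (c ∷ as) uniq)
      u₂ : Unique (c ∷ c′ ∷ bs)
      u₂ = unique-∷ (unique-∉ uniq ∘ ∈-++⁺ʳ as) (unique-++ʳ (c ∷ as) uniq)
      ⊆cs : ∀ {v} → v ∈ (c ∷ as) ++ c′ ∷ bs → v ∈ cs
      ⊆cs = ∈-resp-↭ σ
      parities : odd? (length (c ∷ as)) xor odd? (length (c′ ∷ bs)) ≡ true
      parities = trans (≡-sym (odd?-+ (length (c ∷ as)) _)) (trans (cong odd? (trans (≡-sym (length-++ (c ∷ as))) (↭-length σ))) o)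
      choose : ∃[ ws ] Path c c′ ws × c′ ∷ ws ↭ c ∷ c′ ∷ bs →
               ∃[ vs ] Path c c′ vs × Within (_∈ cs) (c′ ∷ vs) × odd? (length vs) ≡ b
      choose (ws , P , τ) with xor-either b parities
      ... | inj₁ q = c ∷ as , (w₁ , u₁) ,
        within (λ { (here refl) → c′∈ ; (there m) → ⊆cs (∈-++⁺ˡ m) }) , q
      ... | inj₂ q = ws , P ,
        within (λ m → [ (λ { refl → c∈ }) , (λ m′ → ⊆cs (∈-++⁺ʳ (c ∷ as) m′)) ]′ (head-or-tail (∈-resp-↭ τ m))) ,
        trans (cong odd? (suc-injective (↭-length τ))) q

  -- Disjoint paths to an odd cycle.

  -- Routes lead inside F to the cycle cs, which they meet only in their last vertex.
  module Links {cs F : List V} (C : Cycle cs) (C-odd : odd? (length cs) ≡ true) (cs⊆F : cs ⊆ F)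
    (reach : ∀ {x} → x ∈ F → ∃[ c ] ∃[ vs ] Walk x c vs × c ∈ cs × Within (_∈ F) vs) where

    record Route (x : V) : Set where
      constructor route
      field
        end   : V
        inner : List V
        walk  : Walk x end inner
        end∈  : end ∈ cs
        free  : Within (λ v → v ∈ F × v ∉ cs) inner

    open Route

    vertices : ∀ {x} → Route x → List V
    vertices R = end R ∷ inner R

    Linked : V → V → Set
    Linked x y = ∃[ R ] ∃[ Q ] Disjoint (vertices {x} R) (vertices {y} Q)

    linked-sym : ∀ {x y} → Linked x y → Linked y x
    linked-sym (R , Q , d) = Q , R , λ { (m , m′) → d (m′ , m) }

    ¬linked-refl : ∀ {x} → ¬ Linked x x
    ¬linked-refl (R , Q , d) = d (start∈ (walk R) , start∈ (walk Q))

    stop : ∀ {c} → c ∈ cs → Route c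
    stop c∈ = route _ [] nil c∈ (within λ ())

    findRoute : ∀ {x} → x ∈ F → Route x
    findRoute x∈ with reach x∈
    ... | c , vs , w , c∈ , i with firstHit w c∈
    ... | p , ws , w′ , p∈ , d , ⊆vs , _ = route p ws w′ p∈ (within λ m → at i (⊆vs m) , λ m′ → d (m , m′))

    suffix : ∀ {x v} (R : Route x) → v ∈ vertices R → Σ (Route v) λ Q → vertices Q ⊆ vertices R
    suffix (route c ps w c∈ f) m with splitEnd w m
    ... | as , bs , refl , _ , w₂ = route c bs w₂ c∈ (within λ m → at f (∈-++⁺ʳ as m)) ,
      λ { (here q) → here q ; (there m) → there (∈-++⁺ʳ as m) }

    extend : ∀ {x y} → x ∈ F → x ~ y → (R : Route y) → Σ (Route x) λ Q → vertices Q ⊆ x ∷ vertices R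
    extend {x} x∈ e (route c ps w c∈ f) with x ∈? cs
    ... | yes x∈cs = stop x∈cs , λ { (here q) → here q }
    ... | no x∉ = route c (x ∷ ps) (e ∷ʷ w) c∈ (within λ { (here refl) → x∈ , x∉ ; (there m) → at f m }) ,
      λ { (here q) → there (here q) ; (there (here q)) → here q ; (there (there m)) → there (there m) }

    simplify : ∀ {x} (R : Route x) → Σ (Route x) λ Q → vertices Q ⊆ vertices R × Path x (end Q) (inner Q)
    simplify (route c ps w c∈ f) with shorten w
    ... | ws , P , ⊆ps = route c ws (proj₁ P) c∈ (within λ m → at f (⊆ps m)) ,
      (λ { (here q) → here q ; (there m) → there (⊆ps m) }) , P

    -- Follow a route until it hits xs or ys, and then go on along the set hit.
    trace : (N : V → Set) {xs ys : List V} → Disjoint xs ys →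
            (∀ {v} → v ∈ xs → N v → Σ (Route v) λ R → vertices R ⊆ xs × Within N (vertices R)) →
            (∀ {v} → v ∈ ys → N v → Σ (Route v) λ R → vertices R ⊆ ys × Within N (vertices R)) →
            ∀ {y} (Q : Route y) → Within N (vertices Q) →
            Σ (Route y) λ R → Within N (vertices R) × (Disjoint (vertices R) xs ⊎ Disjoint (vertices R) ys)
    trace N {xs} {ys} d fx fy (route c ps w c∈ f) = go w f
      where
        go : ∀ {y ps} → Walk y c ps → Within (λ v → v ∈ F × v ∉ cs) ps → Within N (c ∷ ps) →
             Σ (Route y) λ R → Within N (vertices R) × (Disjoint (vertices R) xs ⊎ Disjoint (vertices R) ys)
        go {y} w f i with y ∈? xs | y ∈? ys
        ... | yes m | _ = let (R , ⊆xs , i′) = fx m (at i (start∈ w)) in R , i′ , inj₂ λ { (m , m′) → d (⊆xs m , m′) }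
        ... | no _ | yes m = let (R , ⊆ys , i′) = fy m (at i (start∈ w)) in R , i′ , inj₁ λ { (m , m′) → d (m′ , ⊆ys m) }
        go nil f i | no y∉xs | no y∉ys = stop c∈ , within (λ { (here refl) → at i (here refl) }) , inj₁ λ { (here refl , m) → y∉xs m }
        go {y} (e ∷ʷ w) f i | no y∉xs | no y∉ys with go w (within λ m → at f (there m)) (within λ { (here q) → at i (here q) ; (there m) → at i (there (there m)) })
        ... | route c′ qs w′ c′∈ f′ , i′ , d′ = route c′ (y ∷ qs) (e ∷ʷ w′) c′∈ (within λ { (here refl) → at f (here refl) ; (there m) → at f′ m }) ,
          within (λ { (here q) → at i′ (here q) ; (there (here refl)) → at i (there (here refl)) ; (there (there m)) → at i′ (there m) }) ,
          [ (λ d″ → inj₁ λ { (here q , m) → d″ (here q , m) ; (there (here refl) , m) → y∉xs m ; (there (there m) , m′) → d″ (there m , m′) }) ,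
            (λ d″ → inj₂ λ { (here q , m) → d″ (here q , m) ; (there (here refl) , m) → y∉ys m ; (there (there m) , m′) → d″ (there m , m′) }) ]′ d′

    -- Given disjoint routes from `x` and `z`, a route from `y` that joins the first of the two it
    -- meets stays disjoint from the other.
    ¬linked-trans : ∀ {x y z} → y ∈ F → ¬ Linked x y → ¬ Linked y z → ¬ Linked x z
    ¬linked-trans y∈ ¬xy ¬yz (R , Q , d) with
      trace (λ _ → ⊤) d (λ m _ → let (R′ , ⊆R) = suffix R m in R′ , ⊆R , within _)
                        (λ m _ → let (Q′ , ⊆Q) = suffix Q m in Q′ , ⊆Q , within _) (findRoute y∈) (within _)
    ... | S , _ , inj₁ d′ = ¬xy (R , S , λ { (m , m′) → d′ (m′ , m) })
    ... | S , _ , inj₂ d′ = ¬yz (S , Q , d′)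

    -- Two vertices `x₁` and `x₂` of one class cannot both have neighbours outside it. The step to
    -- `y₁` gives a route from `x₁` that misses `x₂`. Traced along the disjoint routes `T` from `x₂`
    -- and `P` from `y₂`, it becomes disjoint from `T`, or from `P` and still without `x₂`; in the
    -- second case `x₂` takes the step to `y₂` and then `P`.
    gate : ∀ {x₁ x₂ y₁ y₂} → x₁ ∈ F → x₂ ∈ F → x₁ ≢ x₂ → x₁ ~ y₁ → x₂ ~ y₂ → Linked x₂ y₂ → Linked y₁ x₂ → Linked x₁ x₂
    gate {x₁} {x₂} x₁∈ x₂∈ x₁≢x₂ e₁ e₂ (T₀ , P , d) (Q₁ , Q₂ , d′) with simplify T₀
    ... | T , ⊆T₀ , T-path with extend x₁∈ e₁ Q₁
    ... | Q , ⊆Q = finish (trace (_≢ x₂) (λ { (m , m′) → d (⊆T₀ m , m′) }) alongT alongP Q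
        (within λ m → λ { refl → x₂∉Q (⊆Q m) }))
      where
        x₂∉Q : x₂ ∉ x₁ ∷ vertices Q₁
        x₂∉Q (here q)  = x₁≢x₂ (≡-sym q)
        x₂∉Q (there m) = d′ (m , start∈ (walk Q₂))
        x₂∉P : x₂ ∉ vertices P
        x₂∉P m = d (start∈ (walk T₀) , m)
        alongP : ∀ {v} → v ∈ vertices P → v ≢ x₂ → Σ (Route v) λ R → vertices R ⊆ vertices P × Within (_≢ x₂) (vertices R)
        alongP m _ = let (R , ⊆P) = suffix P m in R , ⊆P , within λ { m refl → x₂∉P (⊆P m) }
        -- `T` is a simple path, so its part after `v` does not return to its start `x₂`.
        alongT : ∀ {v} → v ∈ vertices T → v ≢ x₂ → Σ (Route v) λ R → vertices R ⊆ vertices T × Within (_≢ x₂) (vertices R)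
        alongT m v≢x₂ = go T-path (free T) m
          where
            go : ∀ {ps} → Path x₂ (end T) ps → Within (λ v → v ∈ F × v ∉ cs) ps → _ ∈ end T ∷ ps →
                 Σ (Route _) λ R → vertices R ⊆ end T ∷ ps × Within (_≢ x₂) (vertices R)
            go P′ f m with splitᵖ P′ m
            ... | [] , _ , _ , (nil , _) , _ , _ = ⊥-elim (v≢x₂ refl)
            ... | as@(_ ∷ _) , bs , refl , (_ ∷ʷ _ , _) , (w₂ , _) , dis = route (end T) bs w₂ (end∈ T) (within λ m → at f (∈-++⁺ʳ as m)) ,
              (λ { (here q) → here q ; (there m) → there (∈-++⁺ʳ as m) }) ,
              within λ { m refl → dis (here refl , m) }
        finish : Σ (Route x₁) (λ R → Within (_≢ x₂) (vertices R) × (Disjoint (vertices R) (vertices T) ⊎ Disjoint (vertices R) (vertices P))) → Linked x₁ x₂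
        finish (R , i , inj₁ dis) = R , T , dis
        finish (R , i , inj₂ dis) with extend x₂∈ e₂ P
        ... | S , ⊆S = R , S , λ { (m , m′) → [ (λ { refl → at i m refl }) , (λ m″ → dis (m , m″)) ]′ (head-or-tail (⊆S m′)) }

    -- The two routes have distinct ends on the odd cycle, and the arc between these ends is chosen
    -- with the parity that corrects the total to `b`.
    linked⇒path : ∀ {x y} → Linked x y → ∀ b → ∃[ vs ] Path x y vs × Within (_∈ F) (y ∷ vs) × odd? (length vs) ≡ b
    linked⇒path {x} {y} (R₀ , Q₀ , d₀) b with simplify R₀ | simplify Q₀
    ... | R , ⊆R , P | Q , ⊆Q , P′ = go (reverseᵖ P′) (arcs C C-odd (end∈ R) (end∈ Q) (λ q → d (here refl , here q)) (b xor (odd? (length (inner R)) xor odd? (length (inner Q)))))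
      where
        d : Disjoint (vertices R) (vertices Q)
        d (m , m′) = d₀ (⊆R m , ⊆Q m′)
        inF : ∀ {z} (S : Route z) {v} → v ∈ vertices S → v ∈ F
        inF S (here refl) = cs⊆F (end∈ S)
        inF S (there m)   = proj₁ (at (free S) m)
        parity : ∀ b p q {a r} → a ≡ b xor (p xor q) → r ≡ q → p xor (a xor r) ≡ b
        parity false false false refl refl = refl
        parity false false true  refl refl = refl
        parity false true  false refl refl = refl
        parity false true  true  refl refl = refl
        parity true  false false refl refl = refl
        parity true  false true  refl refl = refl
        parity true  true  false refl refl = refl
        parity true  true  true  refl refl = refl
        go : ∃[ qs ] Path (end Q) y qs × y ∷ qs ↭ end Q ∷ inner Q →
             ∃[ as ] Path (end R) (end Q) as × Within (_∈ cs) (end Q ∷ as) × odd? (length as) ≡ b xor (odd? (length (inner R)) xor odd? (length (inner Q))) →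
             ∃[ vs ] Path x y vs × Within (_∈ F) (y ∷ vs) × odd? (length vs) ≡ b
        go (qs , Q′ , σ) (as , A , A⊆ , o) = inner R ++ as ++ qs ,
            (P ++ᵖ (A ++ᵖ Q′) dA) dP , within all , odd-length
          where
            dA : Disjoint as (y ∷ qs)
            dA (m , m′) with ∈-resp-↭ σ m′
            ... | here refl = unique-∉ (proj₂ A) m
            ... | there m″  = proj₂ (at (free Q) m″) (at A⊆ (there m))
            dP : Disjoint (inner R) (y ∷ as ++ qs)
            dP (m , m′) with ∈-resp-↭ (↭-sym (shift y as qs)) m′
            ... | m″ with ∈-++⁻ as m″
            ... | inj₁ a = proj₂ (at (free R) m) (at A⊆ (there a))
            ... | inj₂ q = d (there m , ∈-resp-↭ σ q)
            all : ∀ {v} → v ∈ y ∷ inner R ++ as ++ qs → v ∈ F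
            all (here refl) = inF Q (start∈ (walk Q))
            all (there m) with ∈-++⁻ (inner R) m
            ... | inj₁ m′ = inF R (there m′)
            ... | inj₂ m′ with ∈-++⁻ as m′
            ... | inj₁ a = cs⊆F (at A⊆ (there a))
            ... | inj₂ q = inF Q (∈-resp-↭ σ (there q))
            odd-length : odd? (length (inner R ++ as ++ qs)) ≡ b
            odd-length = trans (cong odd? (trans (length-++ (inner R)) (cong (length (inner R) +_) (length-++ as))))
              (trans (odd?-+ (length (inner R)) _) (trans (cong (odd? (length (inner R)) xor_) (odd?-+ (length as) (length qs)))
                (parity b (odd? (length (inner R))) (odd? (length (inner Q))) o (cong odd? (suc-injective (↭-length σ))))))

-- Deciding whether two cycles with consecutive odd lengths exist.

module ConsecutiveOddCycles (G : Graph) where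

  open Walks G

  CycleOfLength : ℕ → Set
  CycleOfLength l = ∃[ vs ] length vs ≡ l × Cycle vs

  Win : Set
  Win = ∃[ l ] odd? l ≡ true × CycleOfLength l × CycleOfLength (2 + l)

  win : ∀ {vs ws} → Cycle vs → Cycle ws → odd? (length vs) ≡ true → length ws ≡ 2 + length vs → Win
  win c c′ o l = _ , o , (_ , refl , c) , (_ , l , c′)

  win⇒HasCycle : Win → ∃[ k ] (HasCycle G (2 * k + 1) × HasCycle G (2 * k + 1 + 2))
  win⇒HasCycle (l , o , (vs , refl , c) , (ws , l′ , c′)) with odd?⇒≡1+2* l o
  ... | k , eq = k , subst (HasCycle G) eq (cycle⇒HasCycle c) ,
    subst (HasCycle G) (trans l′ (trans (+-comm 2 _) (cong (_+ 2) eq))) (cycle⇒HasCycle c′)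

  walk? : ∀ x z vs → Dec (Walk x z vs)
  walk? x z [] with x ≟ z
  ... | yes refl = yes nil
  ... | no x≢z   = no λ { nil → x≢z refl }
  walk? x z (v ∷ []) with x ≟ v | Boolₚ.T? (adj G x z)
  ... | yes refl | yes e = yes (e ∷ʷ nil)
  ... | yes refl | no ¬e = no λ { (e ∷ʷ nil) → ¬e e }
  ... | no x≢v   | _     = no λ { (_ ∷ʷ _) → x≢v refl }
  walk? x z (v ∷ v′ ∷ vs) with x ≟ v | Boolₚ.T? (adj G x v′) | walk? v′ z (v′ ∷ vs)
  ... | yes refl | yes e | yes w = yes (e ∷ʷ w)
  ... | yes refl | no ¬e | _     = no λ { (e ∷ʷ (_ ∷ʷ _)) → ¬e e }
  ... | yes refl | yes _ | no ¬w = no λ { (_ ∷ʷ w@(_ ∷ʷ _)) → ¬w w }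
  ... | no x≢v   | _     | _     = no λ { (_ ∷ʷ _) → x≢v refl }

  cycle? : ∀ vs → Dec (Cycle vs)
  cycle? [] = no λ { (_ , _ , _ , ()) }
  cycle? (v ∷ vs) = map′ (λ { (w , u , l) → v , w , u , l }) (λ { (_ , w@(_ ∷ʷ _) , u , l) → w , u , l })
    (walk? v v (v ∷ vs) ×-dec (DecUnique.unique? _≟_ (v ∷ vs) ×-dec (3 ≤? length (v ∷ vs))))

  anyList? : ∀ l {P : List V → Set} → (∀ vs → Dec (P vs)) → Dec (∃[ vs ] length vs ≡ l × P vs)
  anyList? zero    P? = map′ (λ p → [] , refl , p) (λ { ([] , _ , p) → p }) (P? [])
  anyList? (suc l) P? = map′ (λ { (v , vs , eq , p) → v ∷ vs , cong suc eq , p })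
    (λ { (v ∷ vs , eq , p) → v , vs , suc-injective eq , p })
    (any? λ v → anyList? l λ vs → P? (v ∷ vs))

  -- The shorter cycle has at most `n G` vertices, so only finitely many lengths and vertex lists
  -- have to be tried.
  win? : Dec Win
  win? = map′ (λ { (i , p) → toℕ i , p }) bound
    (any? λ (i : Fin (suc (n G))) → (odd? (toℕ i) Boolₚ.≟ true) ×-dec (anyList? (toℕ i) cycle? ×-dec anyList? (2 + toℕ i) cycle?))
    where
      bound : Win → ∃[ i ] odd? (toℕ {suc (n G)} i) ≡ true × CycleOfLength (toℕ i) × CycleOfLength (2 + toℕ i)
      bound (l , o , (vs , refl , c) , c′) = fromℕ< l< ,
        subst (λ l → odd? l ≡ true × CycleOfLength l × CycleOfLength (2 + l)) (≡-sym (toℕ-fromℕ< l<)) (o , (vs , refl , c) , c′)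
        where
          l< : length vs < suc (n G)
          l< = s≤s (unique-length (proj₁ (proj₂ (proj₂ c))))

-- Consequences of the hypotheses on a counterexample.

module Counterexample (G : Graph) (κ : KConnected 3 G) (δ : MinDegreeAtLeast 4 G)
  (noWin : ¬ ConsecutiveOddCycles.Win G) where

  open Walks G
  open ConsecutiveOddCycles G

  degree4 : ∀ v → AtLeast 4 (v ~_)
  degree4 v = _ , Uniqueₚ.filter⁺ (Boolₚ.T? ∘ adj G v) (Uniqueₚ.allFin⁺ (n G)) , δ v ,
    within (λ m → proj₂ (∈-filter⁻ (Boolₚ.T? ∘ adj G v) {xs = allVertices G} m))

  -- The vertices `w` and `w′` may coincide, which covers the removal of a single vertex.
  avoid₂ : ∀ w w′ {x y} → x ≢ w → x ≢ w′ → y ≢ w → y ≢ w′ →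
           ∃[ vs ] Walk x y vs × Within (λ v → v ≢ w × v ≢ w′) (y ∷ vs)
  avoid₂ w w′ x≢w x≢w′ y≢w y≢w′ = let (vs , k , i) = avoid κ X small (∉X x≢w x≢w′) (∉X y≢w y≢w′) in
      vs , k , within λ m → (λ { refl → at i m (Subsetₚ.x∈p∪q⁺ (inj₁ (Subsetₚ.x∈⁅x⁆ w))) }) ,
                            (λ { refl → at i m (Subsetₚ.x∈p∪q⁺ {p = Subset.⁅ w ⁆} (inj₂ (Subsetₚ.x∈⁅x⁆ w′))) })
    where
      X : Subset.Subset (n G)
      X = Subset.⁅ w ⁆ Subset.∪ Subset.⁅ w′ ⁆
      small : suc Subset.∣ X ∣ ≤ 3
      small = s≤s (≤-trans (∣p∪q∣≤∣p∣+∣q∣ Subset.⁅ w ⁆ Subset.⁅ w′ ⁆)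
                (≤-reflexive (cong₂ _+_ (Subsetₚ.∣⁅x⁆∣≡1 w) (Subsetₚ.∣⁅x⁆∣≡1 w′))))
      ∉X : ∀ {v} → v ≢ w → v ≢ w′ → v Subset.∉ X
      ∉X v≢w v≢w′ m with Subsetₚ.x∈p∪q⁻ Subset.⁅ w ⁆ Subset.⁅ w′ ⁆ m
      ... | inj₁ m′ = v≢w (Subsetₚ.x∈⁅y⁆⇒x≡y w m′)
      ... | inj₂ m′ = v≢w′ (Subsetₚ.x∈⁅y⁆⇒x≡y w′ m′)

  -- Maximality of `F`: what remains outside is a single even cycle D.

  module Saturated
    {cs F : List V} (C : Cycle cs) (cs⊆F : cs ⊆ F)
    (saturated : ∀ {r f} → r ∉ F → f ∈ F → r ~ f → ¬ EvenCycleIn (λ x → x ∉ F × x ≢ r))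
    where

    module _ {ds : List V} (D : Cycle ds) (D-even : odd? (length ds) ≡ false) (D∉F : Within (_∉ F) ds) where

      -- Otherwise `r` could be added to `F` with all of D still outside, against maximality.
      boundary⊆ds : ∀ {r f} → r ∉ F → f ∈ F → r ~ f → r ∈ ds
      boundary⊆ds {r} r∉ f∈ e with r ∈? ds
      ... | yes m = m
      ... | no r∉ds = ⊥-elim (saturated r∉ f∈ e (ds , D , D-even , within λ m → at D∉F m , λ { refl → r∉ds m }))

      -- Grow a connected set from D − r inside the complement of F ∪ {r} until a single vertex is
      -- left out; it has three neighbours in the set, which gives an even cycle missing r.
      grow : ∀ {r f rest d} → r ∉ F → f ∈ F → r ~ f → (∀ {x} → x ∈ ds → x ≢ r → x ∈ rest) → d ∈ rest →
             ∀ k {S} → n G < k + length S → Unique S → Connected (_∈ S) → rest ⊆ S → Within (λ x → x ∉ F × x ≢ r) S →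
             ∀ {w} → w ∉ F → w ≢ r → w ∉ S → ¬ ¬ ⊥
      grow _ _ _ _ _ zero l u = ⊥-elim (<-irrefl refl (≤-trans l (unique-length u)))
      grow {r} {f} {rest} {d} r∉ f∈ r~f ds⊆ d∈ (suc k) {S} l u conn rest⊆ S⊆ {w} w∉F w≢r w∉S = do
        let d∉F , d≢r = at S⊆ (rest⊆ d∈)
        let vs , walk , av = avoid₂ r r w≢r w≢r d≢r d≢r
        s , v , s~v , _ , v∈ , (s∉F , s≢r , s∉S) , ¬Iv ← exits {I = λ s → s ∉ F × s ≢ r × s ∉ S} walk
          (w∉F , w≢r , w∉S) (λ { (_ , _ , d∉S) → d∉S (rest⊆ d∈) })
        -- `s` is not on D, since `S` contains D - r and `s` is not `r`; so `boundary⊆ds` denies it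
        -- neighbours in `F`.
        let notF : ∀ {v} → s ~ v → v ∉ F
            notF e v∈F = s∉S (rest⊆ (ds⊆ (boundary⊆ds s∉F v∈F e) s≢r))
            v∈S = stable-∈ λ v∉S → ¬Iv (notF s~v , proj₁ (at av v∈) , v∉S)
            S′⊆ = within λ { (here refl) → s∉F , s≢r ; (there m) → at S⊆ m }
        no ¬other ← em {A = ∃[ z ] (z ∉ F × z ≢ r × z ∉ S) × z ≢ s}
          where yes (z , (z∉F , z≢r , z∉S) , z≢s) →
                  grow r∉ f∈ r~f ds⊆ d∈ k (≤-trans l (≤-reflexive (≡-sym (+-suc k _)))) (unique-∷ s∉S u)
                    (connected-∷ s~v v∈S conn) (there ∘ rest⊆) S′⊆ z∉F z≢r
                    (λ { (here q) → z≢s q ; (there m) → z∉S m })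
        let near : ∀ {y} → s ~ y × y ≢ r → s ~ y × y ∈ S
            near (e , y≢r) = e , stable-∈ λ y∉S → ¬other (_ , (notF e , y≢r , y∉S) , ~⇒≢ e ∘ ≡-sym)
        λ _ → saturated r∉ f∈ r~f (evenCycle-map (λ { (inj₁ refl) → s∉F , s≢r ; (inj₂ m) → at S⊆ m })
          (theta-atLeast {S = _∈ S} conn s∉S (atLeast-map near (atLeast-∉ r (degree4 s)))))

      -- A walk from `w` to C provides a vertex `r` of D with a neighbour in `F`; a vertex `w`
      -- outside both `F` and D lets `grow` start from D - r.
      covers : ∀ {w} → w ∉ F → w ∈ ds
      covers {w} w∉F = stable-∈ λ w∉ds → run do
        let c , c∈ = cycle-vertex C
        let _ , walk = connected κ w c
        r , f , r~f , _ , _ , r∉F , ¬f∉F ← exits {I = _∉ F} walk w∉F (λ c∉F → c∉F (cs⊆F c∈))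
        let f∈F = stable-∈ ¬f∉F
            r∈ds = boundary⊆ds r∉F f∈F r~f
        start r∉F f∈F r~f (cycle-at D r∈ds) (λ { refl → w∉ds r∈ds }) w∉ds
        where
          start : ∀ {r f} → r ∉ F → f ∈ F → r ~ f → ∃[ rest ] Walk r r (r ∷ rest) × r ∷ rest ↭ ds → w ≢ r → w ∉ ds → ¬ ¬ ⊥
          start r∉ f∈ r~f (.[] , e ∷ʷ nil , σ) _ _ = ⊥-elim (~-irrefl e)
          start {r} r∉ f∈ r~f (rest , e ∷ʷ w′@(_ ∷ʷ _) , σ) w≢r w∉ds =
            grow r∉ f∈ r~f ds⊆ (here refl) (suc (n G)) (m≤m+n _ _) (unique-tail u) (walkConnected w′) id
              (within λ m → at D∉F (∈-resp-↭ σ (there m)) , λ { refl → unique-∉ u m }) w∉F w≢r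
              (λ m → w∉ds (∈-resp-↭ σ (there m)))
            where
              u : Unique (r ∷ rest)
              u = Unique-resp-↭ (↭-sym σ) (proj₁ (proj₂ (proj₂ D)))
              ds⊆ : ∀ {x} → x ∈ ds → x ≢ r → x ∈ rest
              ds⊆ m x≢r with ∈-resp-↭ (↭-sym σ) m
              ... | here q   = ⊥-elim (x≢r q)
              ... | there m′ = m′

    -- Without a neighbour in `F`, all neighbours of `u` lie on D, and three of them differ from the
    -- next vertex `z`. The path D - u - z then yields an even cycle outside `F` that misses `z`,
    -- whereas by `covers` such a cycle contains every vertex outside `F`.
    attached : ∀ {ds} → Cycle ds → odd? (length ds) ≡ false → Within (_∉ F) ds →
               ∀ {u} → u ∈ ds → ¬ ¬ (∃[ f ] f ∈ F × u ~ f)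
    attached {ds} D D-even D∉F {u} u∈ k = go (cycle-at D u∈)
      where
        go : ∃[ rest ] Walk u u (u ∷ rest) × u ∷ rest ↭ ds → ⊥
        go (.[] , e ∷ʷ nil , σ) = ~-irrefl e
        go (z ∷ rest , e ∷ʷ (_ ∷ʷ w) , σ) = finish evenCycle
          where
            uniq : Unique (u ∷ z ∷ rest)
            uniq = Unique-resp-↭ (↭-sym σ) (proj₁ (proj₂ (proj₂ D)))
            near : ∀ {y} → u ~ y × y ≢ z → u ~ y × y ∈ rest
            near (e , y≢z) with ∈-resp-↭ (↭-sym σ) (covers D D-even D∉F (λ y∈F → k (_ , y∈F , e)))
            ... | here q          = ⊥-elim (~⇒≢ e (≡-sym q))
            ... | there (here q)  = ⊥-elim (y≢z q)
            ... | there (there m) = e , m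
            evenCycle : EvenCycleIn (λ x → x ∉ F × x ≢ z)
            evenCycle = evenCycle-map
              (λ { (inj₁ refl) → at D∉F u∈ , (λ q → unique-∉ uniq (here q))
                 ; (inj₂ m) → at D∉F (∈-resp-↭ σ (there (there m))) , λ { refl → unique-∉ (unique-tail uniq) m } })
              (theta-atLeast {S = _∈ rest} (walkConnected w) (λ m → unique-∉ uniq (there m)) (atLeast-map near (atLeast-∉ z (degree4 u))))
            finish : ¬ EvenCycleIn (λ x → x ∉ F × x ≢ z)
            finish (ds′ , D′ , e′ , i) = proj₂ (at i (covers D′ e′ (within λ m → proj₁ (at i m))
              (at D∉F (∈-resp-↭ σ (there (here refl)))))) refl

  -- The neighbours of D in `F` lie in two classes, against 3-connectedness.

  module Separated
    {cs F ds : List V} (C : Cycle cs) (C-odd : odd? (length cs) ≡ true) (cs⊆F : cs ⊆ F)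
    (reach : ∀ {x} → x ∈ F → ∃[ c ] ∃[ vs ] Walk x c vs × c ∈ cs × Within (_∈ F) vs)
    (D : Cycle ds) (D-even : odd? (length ds) ≡ false) (D∉F : Within (_∉ F) ds)
    (covers : ∀ {w} → w ∉ F → w ∈ ds)
    (attached : ∀ {u} → u ∈ ds → ¬ ¬ (∃[ f ] f ∈ F × u ~ f))
    where

    open Links C C-odd cs⊆F reach

    throughF : ∀ {u v x y as ms} → u ∈ ds → v ∈ ds → u ≢ v → Path u v as → as ⊆ ds →
               Path x y ms → Within (_∈ F) (y ∷ ms) → u ~ x → v ~ y → 1 ≤ length ms + length as →
               ∃[ ws ] Cycle ws × length ws ≡ 2 + (length ms + length as)
    throughF {u} {v} {x} {y} {as} {ms} u∈ v∈ u≢v P as⊆ M M∈F u~x v~y l =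
        go (snocᵖ (consᵖ u~x u∉ M) (~-sym v~y) v∉) (reverseᵖ P)
      where
        u∉ : u ∉ y ∷ ms
        u∉ m = at D∉F u∈ (at M∈F m)
        v∉ : v ∉ y ∷ u ∷ ms
        v∉ (here refl)       = at D∉F v∈ (at M∈F (here refl))
        v∉ (there (here q))  = u≢v (≡-sym q)
        v∉ (there (there m)) = at D∉F v∈ (at M∈F (there m))
        ∈ds : ∀ {z} → z ∈ v ∷ as → z ∈ ds
        ∈ds (here refl) = v∈
        ∈ds (there m)   = as⊆ m
        go : ∃[ ws ] Path u v ws × ws ↭ y ∷ u ∷ ms → ∃[ rs ] Path v u rs × u ∷ rs ↭ v ∷ as →
             ∃[ ws ] Cycle ws × length ws ≡ 2 + (length ms + length as)
        go (ws , W , σ) (rs , R , τ) = ws ++ rs , close W R d (subst (3 ≤_) (≡-sym len) (s≤s (s≤s l))) , len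
          where
            len : length (ws ++ rs) ≡ 2 + (length ms + length as)
            len = trans (length-++ ws) (cong₂ _+_ (↭-length σ) (suc-injective (↭-length τ)))
            d : Disjoint ws rs
            d (m , m′) with ∈-resp-↭ σ m
            ... | here refl          = at D∉F (∈ds (∈-resp-↭ τ (there m′))) (at M∈F (here refl))
            ... | there (here refl)  = unique-∉ (proj₂ R) m′
            ... | there (there m″)   = at D∉F (∈ds (∈-resp-↭ τ (there m′))) (at M∈F (there m″))

    -- This transfers the relation of not being linked from `F` to the vertices of D, by way of
    -- their neighbours in `F`.
    Unlinked : V → V → Set
    Unlinked u v = ∀ x y → x ∈ F → y ∈ F → u ~ x → v ~ y → ¬ Linked x y

    unlinked-sym : ∀ {u v} → Unlinked u v → Unlinked v u
    unlinked-sym U x y x∈ y∈ e e′ l = U y x y∈ x∈ e′ e (linked-sym l)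

    -- The middle vertex has a neighbour in `F`, through which `¬linked-trans` passes.
    unlinked-trans : ∀ {u v w} → v ∈ ds → Unlinked u v → Unlinked v w → ¬ ¬ Unlinked u w
    unlinked-trans v∈ U U′ = do
      f , f∈ , e ← attached v∈
      return λ x y x∈ y∈ ex ey → ¬linked-trans f∈ (U x f x∈ f∈ ex e) (U′ f y f∈ y∈ e ey)

    -- The arcs of D differ by two in length, and F offers connections of either parity.
    unlinked-arcs : ∀ {u v as bs} → Walk u v as → Walk v u bs → Unique (as ++ bs) → as ++ bs ⊆ ds →
                    1 ≤ length as → length bs ≡ 2 + length as → Unlinked u v
    unlinked-arcs nil _ _ _ ()
    unlinked-arcs (_ ∷ʷ _) nil _ _ _ ()
    unlinked-arcs {u} {v} {as} {bs} w@(_ ∷ʷ _) w′@(_ ∷ʷ _) uniq ⊆ds 1≤ l x y x∈ y∈ u~x v~y linked =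
        -- This parity makes the cycle through `as` odd; the cycle through `bs` is longer by two.
        go (linked⇒path linked (not (odd? (length as)))) (reverseᵖ (w′ , uB))
      where
        u≢v : u ≢ v
        u≢v refl = unique-++-disjoint as uniq (here refl , here refl)
        uA : Unique (v ∷ as)
        uA = unique-∷ (λ m → unique-++-disjoint as uniq (m , here refl)) (unique-++ˡ as uniq)
        uB : Unique (u ∷ bs)
        uB = unique-∷ (λ m → unique-++-disjoint as uniq (here refl , m)) (unique-++ʳ as uniq)
        u∈ : u ∈ ds
        u∈ = ⊆ds (here refl)
        v∈ : v ∈ ds
        v∈ = ⊆ds (∈-++⁺ʳ as (here refl))
        ⊆ds′ : ∀ {z} → z ∈ u ∷ bs → z ∈ ds
        ⊆ds′ (here refl) = u∈
        ⊆ds′ (there m)   = ⊆ds (∈-++⁺ʳ as m)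
        odd : ∀ j k → odd? j ≡ not (odd? k) → odd? (j + k) ≡ true
        odd j k eq = trans (odd?-+ j k) (trans (cong (_xor odd? k) eq) (lem (odd? k)))
          where
            lem : ∀ b → not b xor b ≡ true
            lem true  = refl
            lem false = refl
        go : ∃[ ms ] Path x y ms × Within (_∈ F) (y ∷ ms) × odd? (length ms) ≡ not (odd? (length as)) →
             ∃[ rs ] Path u v rs × v ∷ rs ↭ u ∷ bs → ⊥
        go (ms , M , M∈F , o) (rs , R , σ) =
            noWin (win (proj₁ (proj₂ c₁)) (proj₁ (proj₂ c₂)) (trans (cong odd? (proj₂ (proj₂ c₁))) (cong (not ∘ not) o′)) lengths)
          where
            o′ : odd? (length ms + length as) ≡ true
            o′ = odd (length ms) (length as) o
            lr : length rs ≡ 2 + length as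
            lr = trans (suc-injective (↭-length σ)) l
            lm : length ms + length rs ≡ 2 + (length ms + length as)
            lm = trans (cong (length ms +_) lr) (trans (+-suc (length ms) _) (cong suc (+-suc (length ms) _)))
            c₁ : ∃[ ws ] Cycle ws × length ws ≡ 2 + (length ms + length as)
            c₁ = throughF u∈ v∈ u≢v (w , uA) (⊆ds ∘ ∈-++⁺ˡ) M M∈F u~x v~y (odd?⇒≥1 _ o′)
            c₂ : ∃[ ws ] Cycle ws × length ws ≡ 2 + (length ms + length rs)
            c₂ = throughF u∈ v∈ u≢v R (λ m → ⊆ds′ (∈-resp-↭ σ (there m))) M M∈F u~x v~y (subst (1 ≤_) (≡-sym lm) (s≤s z≤n))
            lengths : length (proj₁ c₂) ≡ 2 + length (proj₁ c₁)
            lengths = trans (proj₂ (proj₂ c₂)) (cong (2 +_) (trans lm (≡-sym (proj₂ (proj₂ c₁)))))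

    D-unique : Unique ds
    D-unique = proj₁ (proj₂ (proj₂ D))

    -- With t opposite to z, both x, t and t, y are at distance |D|/2 − 1 on D.
    unlinked-second : ∀ {y z x rest} → Walk y x (y ∷ z ∷ []) → Walk x y rest → y ∷ z ∷ rest ↭ ds → ¬ ¬ Unlinked y x
    unlinked-second {y} {z} {x} {rest} w w′ σ = go (even⇒double (length rest) even)
      where
        even : odd? (length rest) ≡ false
        even = Boolₚ.not-injective (Boolₚ.not-injective (trans (cong odd? (↭-length σ)) D-even))
        go : ∃[ j ] length rest ≡ j + j → ¬ ¬ Unlinked y x
        go (zero , l) = ⊥-elim (absurd (subst (3 ≤_) (trans (≡-sym (↭-length σ)) (cong (2 +_) l)) (proj₂ (proj₂ (proj₂ D)))))
          where
            absurd : ¬ 3 ≤ 2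
            absurd (s≤s (s≤s ()))
        go (suc j , l) with walk-take (suc j) (suc j) w′ l
        ... | t , as , bs , refl , la , lb , w₁ , w₂ = ¬¬-map unlinked-sym (unlinked-trans t∈
            (unlinked-arcs w₁ (w₂ ++ʷ w) (Unique-resp-↭ (↭-sym σ₁) D-unique) (∈-resp-↭ σ₁) (subst (1 ≤_) (≡-sym la) (s≤s z≤n))
              (trans (length-++ bs) (trans (+-comm _ 2) (cong (2 +_) (trans lb (≡-sym la))))))
            (unlinked-arcs w₂ (w ++ʷ w₁) (Unique-resp-↭ (↭-sym σ₂) D-unique) (∈-resp-↭ σ₂) (subst (1 ≤_) (≡-sym lb) (s≤s z≤n))
              (cong (2 +_) (trans la (≡-sym lb)))))
          where
            σ₁ : as ++ bs ++ y ∷ z ∷ [] ↭ ds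
            σ₁ = ↭-trans (↭-reflexive (≡-sym (++-assoc as bs _))) (↭-trans (++-comm (as ++ bs) (y ∷ z ∷ [])) σ)
            σ₂ : bs ++ y ∷ z ∷ as ↭ ds
            σ₂ = ↭-trans (++-comm bs (y ∷ z ∷ as)) σ
            t∈ : t ∈ ds
            t∈ with start∈ w₂
            ... | here refl = ∈-resp-↭ σ (here refl)
            ... | there m   = ∈-resp-↭ σ (there (there (∈-++⁺ʳ as m)))

    -- Go from `u` to the vertex two steps further on D and back again.
    unlinked-refl : ∀ {u} → u ∈ ds → ¬ ¬ Unlinked u u
    unlinked-refl {u} u∈ = go (cycle-at D u∈)
      where
        go : ∃[ rest ] Walk u u (u ∷ rest) × u ∷ rest ↭ ds → ¬ ¬ Unlinked u u
        go (.[] , e ∷ʷ nil , σ) = ⊥-elim (~-irrefl e)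
        go (.(_ ∷ _) , e ∷ʷ (e′ ∷ʷ w) , σ) = do
          U ← unlinked-second (e ∷ʷ (e′ ∷ʷ nil)) w σ
          unlinked-trans (∈-resp-↭ σ (∈-insert (start∈ w))) U (unlinked-sym U)

    module _ (p q : V) where

      TwoClasses : V → Set
      TwoClasses v = Unlinked v p ⊎ Unlinked v q

      -- The relation holds between vertices at distance two along D, so the two classes alternate
      -- around D. The list `pre` keeps the part already passed, so that D can be rotated to the
      -- current vertex.
      chain : ∀ post {r pre a b} → Walk r a pre → Walk a r (a ∷ b ∷ post) → pre ++ a ∷ b ∷ post ↭ ds →
              TwoClasses a → TwoClasses b → ∀ {v} → v ∈ post → ¬ ¬ TwoClasses v
      chain (c ∷ post) {pre = pre} {a} {b} w (e ∷ʷ (e′ ∷ʷ w′@(_ ∷ʷ _))) σ Qa Qb m = do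
        U ← unlinked-second (e ∷ʷ (e′ ∷ʷ nil)) (w′ ++ʷ w) (↭-trans (++-comm (a ∷ b ∷ c ∷ post) pre) σ)
        Qc ← transport (∈-resp-↭ σ (∈-++⁺ʳ pre (here refl))) (unlinked-sym U) Qa
        next Qc m
        where
          transport : ∀ {u v} → u ∈ ds → Unlinked v u → TwoClasses u → ¬ ¬ TwoClasses v
          transport u∈ U (inj₁ U′) = ¬¬-map inj₁ (unlinked-trans u∈ U U′)
          transport u∈ U (inj₂ U′) = ¬¬-map inj₂ (unlinked-trans u∈ U U′)
          next : TwoClasses c → ∀ {v} → v ∈ c ∷ post → ¬ ¬ TwoClasses v
          next Qc (here refl) = return Qc
          next Qc (there m) = chain post (w ++ʷ (e ∷ʷ nil)) (e′ ∷ʷ w′) (↭-trans (↭-reflexive (++-assoc pre [ a ] _)) σ) Qb Qc m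

    twoClasses : ¬ ¬ (∃[ p ] ∃[ q ] p ∈ ds × q ∈ ds × (∀ v → v ∈ ds → ¬ ¬ TwoClasses p q v))
    twoClasses = let (p , p∈) = cycle-vertex D in go p∈ (cycle-at D p∈)
      where
        go : ∀ {p} → p ∈ ds → ∃[ rest ] Walk p p (p ∷ rest) × p ∷ rest ↭ ds →
             ¬ ¬ (∃[ p ] ∃[ q ] p ∈ ds × q ∈ ds × (∀ v → v ∈ ds → ¬ ¬ TwoClasses p q v))
        go p∈ (.[] , e ∷ʷ nil , σ) = ⊥-elim (~-irrefl e)
        go {p} p∈ (q ∷ post , w@(_ ∷ʷ (_ ∷ʷ _)) , σ) = do
          Up ← unlinked-refl p∈
          Uq ← unlinked-refl q∈
          return (p , q , p∈ , q∈ , λ v v∈ → classify Up Uq (∈-resp-↭ (↭-sym σ) v∈))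
          where
            q∈ : q ∈ ds
            q∈ = ∈-resp-↭ σ (there (here refl))
            classify : Unlinked p p → Unlinked q q → ∀ {v} → v ∈ p ∷ q ∷ post → ¬ ¬ TwoClasses p q v
            classify Up Uq (here refl)         = return (inj₁ Up)
            classify Up Uq (there (here refl)) = return (inj₂ Uq)
            classify Up Uq (there (there m))   = chain p q post nil w σ (inj₁ Up) (inj₂ Uq) m

    -- The class of `x₀` consists of the vertices of `F` not linked to it; `w` is the only vertex
    -- through which an edge inside `F` can leave this class.
    IsGate : V → V → Set
    IsGate x₀ w = ∀ x y → x ∈ F → y ∈ F → x ~ y → ¬ Linked x x₀ → ¬ ¬ Linked y x₀ → x ≡ w

    -- By `gate`, two vertices of a class that both have neighbours in `F` outside the class
    -- coincide.
    findGate : ∀ {x₀} → x₀ ∈ F → ¬ ¬ (∃[ w ] w ∈ F × ¬ Linked w x₀ × IsGate x₀ w)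
    findGate {x₀} x₀∈ = do
      yes (w , z , w∈ , z∈ , w~z , ¬lw , ¬¬lz) ← em {A = ∃[ x ] ∃[ y ] x ∈ F × y ∈ F × x ~ y × ¬ Linked x x₀ × ¬ ¬ Linked y x₀}
        -- If no edge inside `F` leaves the class, any of its vertices serves as gate; `x₀` is
        -- taken.
        where no ¬b → return (x₀ , x₀∈ , ¬linked-refl , λ x y x∈ y∈ e ¬l ¬¬l → ⊥-elim (¬b (x , y , x∈ , y∈ , e , ¬l , ¬¬l)))
      let leaves : ∀ {y} → ¬ ¬ Linked y x₀ → ¬ ¬ Linked y w
          leaves ¬¬l ¬l = ¬¬l (¬linked-trans w∈ ¬l ¬lw)
      return (w , w∈ , ¬lw , λ x y x∈ y∈ e ¬l ¬¬l → decidable-stable (x ≟ w) λ x≢w →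
        leaves ¬¬l λ l → leaves ¬¬lz λ l′ →
          ¬linked-trans x₀∈ ¬l (¬lw ∘ linked-sym) (gate x∈ w∈ x≢w e w~z (linked-sym l′) l))

    -- Distinct vertices of C are linked by trivial routes, so each class contains at most one
    -- vertex of C. Since C has at least three, one is in neither class.
    escapes : ∀ {x₀ x₁} → x₀ ∈ F → x₁ ∈ F → ¬ ¬ (∃[ c ] c ∈ cs × ¬ ¬ Linked c x₀ × ¬ ¬ Linked c x₁)
    escapes {x₀} {x₁} x₀∈ x₁∈ k with atLeast₃ {P = _∈ cs} (cs , proj₁ (proj₂ (proj₂ C)) , proj₂ (proj₂ (proj₂ C)) , within id)
    ... | a , b , c , (a≢b , a≢c , b≢c) , a∈ , b∈ , c∈ =
        side a∈ λ sa → side b∈ λ sb → side c∈ λ sc → pigeon sa sb sc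
      where
        side : ∀ {c} → c ∈ cs → ¬ ¬ (¬ Linked c x₀ ⊎ ¬ Linked c x₁)
        side c∈ k′ = k (_ , c∈ , k′ ∘ inj₁ , k′ ∘ inj₂)
        apart : ∀ {x c c′} → x ∈ F → c ∈ cs → c′ ∈ cs → c ≢ c′ → ¬ Linked c x → ¬ Linked c′ x → ⊥
        apart x∈ c∈ c′∈ c≢c′ ¬l ¬l′ = ¬linked-trans x∈ ¬l (¬l′ ∘ linked-sym) (stop c∈ , stop c′∈ , λ { (here p , here q) → c≢c′ (trans (≡-sym p) q) })
        pigeon : (¬ Linked a x₀ ⊎ ¬ Linked a x₁) → (¬ Linked b x₀ ⊎ ¬ Linked b x₁) → (¬ Linked c x₀ ⊎ ¬ Linked c x₁) → ⊥
        pigeon (inj₁ p) (inj₁ q) _        = apart x₀∈ a∈ b∈ a≢b p q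
        pigeon (inj₂ p) (inj₂ q) _        = apart x₁∈ a∈ b∈ a≢b p q
        pigeon (inj₁ p) (inj₂ _) (inj₁ r) = apart x₀∈ a∈ c∈ a≢c p r
        pigeon (inj₂ p) (inj₁ _) (inj₂ r) = apart x₁∈ a∈ c∈ a≢c p r
        pigeon (inj₁ _) (inj₂ q) (inj₂ r) = apart x₁∈ b∈ c∈ b≢c q r
        pigeon (inj₂ _) (inj₁ q) (inj₁ r) = apart x₀∈ b∈ c∈ b≢c q r

    -- The two gates separate D from C.
    impossible : ¬ ¬ ⊥
    impossible = do
      p , q , p∈ , q∈ , classes ← twoClasses
      x₀ , x₀∈ , p~x₀ ← attached p∈
      x₁ , x₁∈ , q~x₁ ← attached q∈
      w , w∈ , ¬lw , gate₀ ← findGate x₀∈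
      w′ , w′∈ , ¬lw′ , gate₁ ← findGate x₁∈
      c , c∈ , l₀ , l₁ ← escapes x₀∈ x₁∈
      let ≢∈F : ∀ {f} → f ∈ F → p ≢ f
          ≢∈F f∈ p≡f = at D∉F p∈ (subst (_∈ F) (≡-sym p≡f) f∈)
          _ , walk , av = avoid₂ w w′ (≢∈F w∈) (≢∈F w′∈) (λ { refl → l₀ ¬lw }) (λ { refl → l₁ ¬lw′ })
      -- The set `I` consists of the vertices outside `F` and those in the two classes. From a
      -- vertex of `F` it can be left only at a gate, which the walk avoids, and from D it cannot be
      -- left, by `classes`.
      u , v , u~v , u∈ , _ , Iu , ¬Iv ← exits {I = λ v → v ∈ F → ¬ Linked v x₀ ⊎ ¬ Linked v x₁} walk
        (λ p∈F → ⊥-elim (at D∉F p∈ p∈F)) (λ Ic → [ l₀ , l₁ ]′ (Ic (cs⊆F c∈)))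
      let v∈F = stable-∈ λ v∉F → ¬Iv (⊥-elim ∘ v∉F)
          fromF : u ∈ F → ⊥
          fromF u∈F = [ (λ ¬l → proj₁ (at av (there u∈)) (gate₀ u v u∈F v∈F u~v ¬l λ ¬l′ → ¬Iv λ _ → inj₁ ¬l′)) ,
                        (λ ¬l → proj₂ (at av (there u∈)) (gate₁ u v u∈F v∈F u~v ¬l λ ¬l′ → ¬Iv λ _ → inj₂ ¬l′)) ]′ (Iu u∈F)
      cl ← classes u (covers fromF)
      λ _ → ¬Iv λ _ → [ (λ U → inj₁ (U v x₀ v∈F x₀∈ u~v p~x₀)) , (λ U → inj₂ (U v x₁ v∈F x₁∈ u~v q~x₁)) ]′ cl

  -- Starting from C, `F` absorbs adjacent vertices as long as an even cycle remains outside it; `k`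
  -- bounds the number of steps. When this stops, `F` is maximal and the separation argument
  -- applies.
  disjoint-odd-even : ∀ {cs} → Cycle cs → odd? (length cs) ≡ true → ¬ EvenCycleIn (_∉ cs)
  disjoint-odd-even {cs} C C-odd E = go (suc (n G)) (m≤m+n _ _) (proj₁ (proj₂ (proj₂ C))) id
      (λ c∈ → _ , [] , nil , c∈ , within λ ()) E id
    where
      go : ∀ k {F} → n G < k + length F → Unique F → cs ⊆ F →
           (∀ {x} → x ∈ F → ∃[ c ] ∃[ vs ] Walk x c vs × c ∈ cs × Within (_∈ F) vs) → EvenCycleIn (_∉ F) → ¬ ¬ ⊥
      go zero l u = ⊥-elim (<-irrefl refl (≤-trans l (unique-length u)))
      go (suc k) {F} l u cs⊆F reach (ds , D , D-even , D∉F) = do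
        no ¬more ← em {A = ∃[ r ] ∃[ f ] r ∉ F × f ∈ F × r ~ f × EvenCycleIn (λ x → x ∉ F × x ≢ r)}
          where yes (r , f , r∉ , f∈ , e , E′) → go k {r ∷ F} (≤-trans l (≤-reflexive (≡-sym (+-suc k _)))) (unique-∷ r∉ u) (there ∘ cs⊆F)
                  (reach′ f∈ e) (evenCycle-map (λ { (x∉ , x≢r) → λ { (here q) → x≢r q ; (there m) → x∉ m } }) E′)
        let saturated : ∀ {r f} → r ∉ F → f ∈ F → r ~ f → ¬ EvenCycleIn (λ x → x ∉ F × x ≢ r)
            saturated r∉ f∈ e E′ = ¬more (_ , _ , r∉ , f∈ , e , E′)
        Separated.impossible C C-odd cs⊆F reach D D-even D∉F
          (Saturated.covers C cs⊆F saturated D D-even D∉F)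
          (Saturated.attached C cs⊆F saturated D D-even D∉F)
        where
          reach′ : ∀ {r f} → f ∈ F → r ~ f → ∀ {x} → x ∈ r ∷ F → ∃[ c ] ∃[ vs ] Walk x c vs × c ∈ cs × Within (_∈ r ∷ F) vs
          reach′ f∈ e (here refl) with reach f∈
          ... | c , vs , w , c∈ , i = c , _ , e ∷ʷ w , c∈ , within λ { (here q) → here q ; (there m) → there (at i m) }
          reach′ f∈ e (there m) with reach m
          ... | c , vs , w , c∈ , i = c , vs , w , c∈ , within λ m → there (at i m)

  -- The case of a triangle.

  module Triangle {cs : List V} (C : Cycle cs) (C-odd : odd? (length cs) ≡ true) (C-length : length cs ≡ 3) where

    Heavy : V → Set
    Heavy v = v ∉ cs × AtLeast 2 (λ x → v ~ x × x ∈ cs)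

    heavy-or-free : ∀ {v} → v ∉ cs → Heavy v ⊎ AtLeast 3 (λ x → v ~ x × x ∉ cs)
    heavy-or-free {v} v∉ with atLeast-split 1 2 (_∈? cs) (degree4 v)
    ... | inj₁ al = inj₁ (v∉ , al)
    ... | inj₂ al = inj₂ al

    -- The triangle has room for only three of the four neighbours.
    free-neighbour : ∀ v → ∃[ x ] v ~ x × x ∉ cs
    free-neighbour v with atLeast-split 3 0 (_∈? cs) (degree4 v)
    ... | inj₂ al = atLeast₁ al
    ... | inj₁ (xs , u , l , i) = ⊥-elim (1+n≰n (≤-trans l (≤-trans (unique-⊆-length u (λ m → proj₂ (at i m))) (≤-reflexive C-length))))

    distinct-ends : ∀ {v w} → Heavy v → Heavy w → ∃[ t ] ∃[ t′ ] v ~ t × w ~ t′ × t ∈ cs × t′ ∈ cs × t ≢ t′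
    distinct-ends (_ , al) (_ , al′) with atLeast₁ (atLeast-pred al)
    ... | t , e , t∈ with atLeast₁ (atLeast-∉ t al′)
    ... | t′ , (e′ , t′∈) , t′≢t = t , t′ , e , e′ , t∈ , t′∈ , t′≢t ∘ ≡-sym

    -- A nontrivial path on at most three vertices has length one or two, so its parity determines
    -- its length.
    evenArc : ∀ {t t′} → t ∈ cs → t′ ∈ cs → t ≢ t′ → ∃[ vs ] Path t t′ vs × Within (_∈ cs) (t′ ∷ vs) × length vs ≡ 2
    evenArc t∈ t′∈ t≢t′ with arcs C C-odd t∈ t′∈ t≢t′ false
    ... | vs , P , i , e = vs , P , i , two vs P e (≤-trans (unique-⊆-length (proj₂ P) (at i)) (≤-reflexive C-length))
      where
        two : ∀ vs → Path _ _ vs → odd? (length vs) ≡ false → suc (length vs) ≤ 3 → length vs ≡ 2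
        two [] (nil , _) _ _ = ⊥-elim (t≢t′ refl)
        two (_ ∷ _ ∷ []) _ _ _ = refl
        two (_ ∷ _ ∷ _ ∷ _) _ _ (s≤s (s≤s (s≤s ())))

    oddArc : ∀ {t t′} → t ∈ cs → t′ ∈ cs → t ≢ t′ → ∃[ vs ] Path t t′ vs × Within (_∈ cs) (t′ ∷ vs) × length vs ≡ 1
    oddArc t∈ t′∈ t≢t′ with arcs C C-odd t∈ t′∈ t≢t′ true
    ... | vs , P , i , e = vs , P , i , one vs e (≤-trans (unique-⊆-length (proj₂ P) (at i)) (≤-reflexive C-length))
      where
        one : ∀ vs → odd? (length {A = V} vs) ≡ true → suc (length vs) ≤ 3 → length vs ≡ 1
        one (_ ∷ []) _ _ = refl
        one (_ ∷ _ ∷ _ ∷ _) _ (s≤s (s≤s (s≤s ())))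

    -- Together with the triangle it would form the excluded pair of cycles.
    no-5-cycle : ∀ {xs} → CycleOn xs → length xs ≢ 5
    no-5-cycle (vs , c , σ) l = noWin (win C c C-odd (trans (trans (↭-length σ) l) (cong (2 +_) (≡-sym C-length))))

    -- The edge and the two-edge arc between distinct neighbours `t` and `t′` on C would form a
    -- 5-cycle.
    heavy-not-adjacent : ∀ {v w} → Heavy v → Heavy w → ¬ v ~ w
    heavy-not-adjacent {v} {w} hv hw v~w with distinct-ends hv hw
    ... | t , t′ , v~t , w~t′ , t∈ , t′∈ , t≢t′ with evenArc t∈ t′∈ t≢t′
    ... | vs , P , i , l with snocᵖ P (~-sym w~t′) (proj₁ hw ∘ at i)
    ... | ws , Q , σ = no-5-cycle (apex v~t (~-sym v~w) (λ { refl → proj₁ hw t∈ }) Q v∉) (cong (2 +_) (trans (↭-length σ) (cong suc l)))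
      where
        v∉ : v ∉ w ∷ ws
        v∉ (here q)  = ~⇒≢ v~w q
        v∉ (there m) = proj₁ hv (at i (∈-resp-↭ σ m))

    -- The path through `u` and the edge between distinct neighbours `t` and `t′` on C would form a
    -- 5-cycle.
    no-common-neighbour : ∀ {u v w} → Heavy v → Heavy w → v ≢ w → u ∉ cs → v ~ u → ¬ u ~ w
    no-common-neighbour {u} {v} {w} hv hw v≢w u∉ v~u u~w with distinct-ends hv hw
    ... | t , t′ , v~t , w~t′ , t∈ , t′∈ , t≢t′ with oddArc t∈ t′∈ t≢t′
    ... | vs , P , i , l with snocᵖ P (~-sym w~t′) (proj₁ hw ∘ at i)
    ... | ws , Q , σ with snocᵖ Q (~-sym u~w) (λ { (here q) → ~⇒≢ u~w q ; (there m) → u∉ (at i (∈-resp-↭ σ m)) })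
    ... | ws′ , Q′ , σ′ = no-5-cycle (apex v~t (~-sym v~u) (λ { refl → u∉ t∈ }) Q′ v∉)
        (cong (2 +_) (trans (↭-length σ′) (cong suc (trans (↭-length σ) (cong suc l)))))
      where
        v∉ : v ∉ u ∷ ws′
        v∉ (here q) = ~⇒≢ v~u q
        v∉ (there m) with ∈-resp-↭ σ′ m
        ... | here q   = v≢w q
        ... | there m′ = proj₁ hv (at i (∈-resp-↭ σ m′))

    -- Otherwise G - C has minimum degree three, hence an even cycle, which is disjoint from C.
    heavy-exists : ¬ ¬ (∃[ v ] Heavy v)
    heavy-exists k = minDegree3⇒evenCycle {K = _∉ cs} deg (proj₂ (proj₂ (free-neighbour (proj₁ (cycle-vertex C))))) (disjoint-odd-even C C-odd)
      where
        deg : ∀ {v} → v ∉ cs → AtLeast 3 (λ x → v ~ x × x ∉ cs)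
        deg v∉ with heavy-or-free v∉
        ... | inj₁ h  = ⊥-elim (k (_ , h))
        ... | inj₂ al = al

    module _ {v : V} (hv : Heavy v) where

      Rest : V → Set
      Rest x = x ∉ cs × x ≢ v

      -- An even cycle would be disjoint from C, and an odd one from the 4-cycle through `v` and all
      -- of C.
      acyclic : ∀ {zs} → Cycle zs → ¬ Within Rest zs
      acyclic {zs} Z i with odd? (length zs) in o
      ... | false = disjoint-odd-even C C-odd (zs , Z , o , within (proj₁ ∘ at i))
      ... | true  = disjoint-odd-even Z o fourCycle
        where
          fourCycle : EvenCycleIn (_∉ zs)
          fourCycle with atLeast₂ (proj₂ hv)
          ... | t , t′ , t≢t′ , (v~t , t∈) , (v~t′ , t′∈) with evenArc t∈ t′∈ t≢t′
          ... | vs , P , j , l with apex v~t (~-sym v~t′) t≢t′ P (proj₁ hv ∘ at j)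
          ... | ws , c , σ = ws , c , cong odd? (trans (↭-length σ) (cong (2 +_) l)) ,
                within λ m m′ → [ (λ { refl → proj₂ (at i m′) refl }) , (λ m″ → proj₁ (at i m′) (at j m″)) ]′ (head-or-tail (∈-resp-↭ σ m))

      -- Otherwise `u` has two neighbours in `Rest`, both on the path by maximality, and these give
      -- a cycle.
      end-heavy : ∀ {u z vs} → LongestIn Rest u z vs → Heavy u
      end-heavy L@(P , i , _) with heavy-or-free (proj₁ (at i (start∈ (proj₁ P))))
      ... | inj₁ h = h
      ... | inj₂ al with backCycle P (atLeast-map (λ { ((e , x∉) , x≢v) → e , longest-closed L e (x∉ , x≢v) }) (atLeast-∉ v al))
      ... | zs , Z , ⊆P = ⊥-elim (acyclic Z (within (at i ∘ ⊆P)))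

      -- The first vertex `u` is heavy, so a path of one vertex can be extended. Otherwise the
      -- second vertex `u₁` is not heavy and has two neighbours in `Rest` other than `u`. If one of
      -- them is off the path, exchanging it for `u` gives another longest path, whose first vertex
      -- is heavy too and shares the neighbour `u₁` with `u`. If both are on the path, there is a
      -- cycle in `Rest`.
      no-longest : ∀ {u z vs} → ¬ LongestIn Rest u z vs
      no-longest {u} L@((nil , _) , i , _) = ~⇒≢ u~x (x≡u x∈)
        where
          hu : Heavy u
          hu = end-heavy L
          x : V
          x = proj₁ (free-neighbour u)
          u~x : u ~ x
          u~x = proj₁ (proj₂ (free-neighbour u))
          x∈ : x ∈ u ∷ []
          x∈ = longest-closed L u~x (proj₂ (proj₂ (free-neighbour u)) ,
                 λ x≡v → heavy-not-adjacent hu hv (subst (u ~_) x≡v u~x))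
          x≡u : x ∈ u ∷ [] → u ≡ x
          x≡u (here q) = ≡-sym q
      no-longest {u} {z} L@((_∷ʷ_ {y = u₁} {vs = us} e w , uniq) , i , max) with heavy-or-free (proj₁ (at i (∈-insert (start∈ w))))
      ... | inj₁ h₁ = heavy-not-adjacent (end-heavy L) h₁ e
      ... | inj₂ al = run do
          no ¬w ← em {A = ∃[ x ] u₁ ~ x × Rest x × x ≢ u × x ∉ z ∷ us}
            where yes (x , e′ , Jx , x≢u , x∉) → λ _ → no-common-neighbour hu (end-heavy (swap-end e′ Jx x∉)) (x≢u ∘ ≡-sym) u₁∉ e e′
          let on-tail : ∀ {x} → (u₁ ~ x × x ∉ cs) × x ≢ u → u₁ ~ x × x ∈ z ∷ us
              on-tail ((e′ , x∉) , x≢u) = e′ , stable-∈ λ x∉P → ¬w (_ , e′ , (x∉ , not-v e′) , x≢u , x∉P)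
              zs , Z , ⊆P = backCycle tail (atLeast-map on-tail (atLeast-∉ u al))
          λ _ → acyclic Z (within λ m → at i (∈-insert (⊆P m)))
        where
          hu : Heavy u
          hu = end-heavy L
          u₁∉ : u₁ ∉ cs
          u₁∉ = proj₁ (at i (∈-insert (start∈ w)))
          tail : Path u₁ z us
          tail = w , unique-tail (Unique-resp-↭ (swap z u ↭-refl) uniq)
          not-v : ∀ {x} → u₁ ~ x → x ≢ v
          not-v e′ refl = no-common-neighbour hu hv (proj₂ (at i (there (here refl)))) u₁∉ e e′
          swap-end : ∀ {x} → u₁ ~ x → Rest x → x ∉ z ∷ us → LongestIn Rest x z (x ∷ us)
          swap-end e′ Jx x∉ = consᵖ (~-sym e′) x∉ tail ,
            within (λ { (here q) → at i (here q) ; (there (here refl)) → Jx ; (there (there m)) → at i (there (there m)) }) , max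

    impossible : ¬ ¬ ⊥
    impossible = do
      v , hv ← heavy-exists
      let x , v~x , x∉ = free-neighbour v
      _ , _ , _ , L ← longest {K = Rest hv} (x∉ , ~⇒≢ v~x ∘ ≡-sym)
      λ _ → no-longest hv L

  -- The case of a shortest odd cycle of length at least five.

  module Long {cs : List V} (C : Cycle cs) (C-odd : odd? (length cs) ≡ true) (C-length : 5 ≤ length cs)
    (shortest : ∀ {zs} → Cycle zs → odd? (length zs) ≡ true → length cs ≤ length zs) where

    C-unique : Unique cs
    C-unique = proj₁ (proj₂ (proj₂ C))

    split-lengths : ∀ {as bs} → as ++ bs ↭ cs → length as + length bs ≡ length cs
    split-lengths {as} σ = trans (≡-sym (length-++ as)) (↭-length σ)

    arc-path : ∀ {x y} as {bs} → Walk x y as → Walk y x (y ∷ bs) → as ++ y ∷ bs ↭ cs → Path x y as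
    arc-path as w w′ σ = w , unique-∷ (λ m → unique-++-disjoint as u (m , here refl)) (unique-++ˡ as u)
      where
        u : Unique (as ++ _)
        u = Unique-resp-↭ (↭-sym σ) C-unique

    -- The odd arc and the two edges at `v` form an odd cycle; as C is shortest, the other arc has
    -- at most two edges.
    odd-arc : ∀ {v x y as bs} → v ∉ cs → v ~ x → v ~ y → x ≢ y → Walk x y as → Walk y x (y ∷ bs) → as ++ y ∷ bs ↭ cs →
              odd? (length as) ≡ true → suc (length bs) ≤ 2
    odd-arc {v} {x} {y} {as} {bs} v∉ v~x v~y x≢y w w′ σ o with apex v~x (~-sym v~y) x≢y (arc-path as w w′ σ) v∉′
      where
        v∉′ : v ∉ y ∷ as
        v∉′ (here refl) = v∉ (∈-resp-↭ σ (∈-++⁺ʳ as (here refl)))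
        v∉′ (there m)   = v∉ (∈-resp-↭ σ (∈-++⁺ˡ m))
    ... | zs , Z , τ = +-cancelˡ-≤ (length as) _ _ (≤-trans (≤-reflexive (split-lengths {as} σ))
          (≤-trans (shortest Z (trans (cong odd? (↭-length τ)) (cong (not ∘ not) o))) (≤-reflexive (trans (↭-length τ) (+-comm 2 (length as))))))

    -- One of the two arcs is odd, and the other, being even and bounded by `odd-arc`, has exactly
    -- two edges.
    even-arc : ∀ {v x y as bs} → v ∉ cs → v ~ x → v ~ y → x ≢ y → Walk x y (x ∷ as) → Walk y x (y ∷ bs) → (x ∷ as) ++ y ∷ bs ↭ cs →
               length as ≡ 1 ⊎ length bs ≡ 1
    even-arc {x = x} {y} {as} {bs} v∉ v~x v~y x≢y w w′ σ = pick (odd? (length (x ∷ as))) (odd? (length (y ∷ bs))) refl refl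
        (trans (≡-sym (odd?-+ (length (x ∷ as)) _)) (trans (cong odd? (split-lengths {x ∷ as} σ)) C-odd))
      where
        one : ∀ k → suc k ≤ 2 → not (odd? k) ≡ false → k ≡ 1
        one (suc zero) _ _ = refl
        one (suc (suc k)) (s≤s (s≤s ()))
        pick : ∀ a b → odd? (length (x ∷ as)) ≡ a → odd? (length (y ∷ bs)) ≡ b → a xor b ≡ true → length as ≡ 1 ⊎ length bs ≡ 1
        pick true  false o e _ = inj₂ (one _ (odd-arc v∉ v~x v~y x≢y w w′ σ o) e)
        pick false true  e o _ = inj₁ (one _ (odd-arc v∉ v~y v~x (x≢y ∘ ≡-sym) w′ w (↭-trans (++-comm (y ∷ bs) (x ∷ as)) σ) o) e)

    -- If the first arc were odd, `odd-arc` would make the second a single edge. That arc is odd as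
    -- well, so the other two have at most two edges together, and C at most three.
    three-arcs : ∀ {v a b c as bs es} → v ∉ cs → v ~ a → v ~ b → v ~ c → a ≢ b → b ≢ c →
                 Walk a b (a ∷ as) → Walk b c (b ∷ bs) → Walk c a (c ∷ es) → (a ∷ as) ++ (b ∷ bs) ++ c ∷ es ↭ cs →
                 odd? (length (a ∷ as)) ≢ true
    three-arcs {v} {a} {b} {c} {as} {bs} {es} v∉ va vb vc a≢b b≢c w₁ w₂ w₃ σ o =
        go bs (odd-arc v∉ va vb a≢b w₁ (w₂ ++ʷ w₃) σ o) (odd-arc v∉ vb vc b≢c w₂ (w₃ ++ʷ w₁) σ′)
          (trans (≡-sym (split-lengths {a ∷ as} σ)) (cong (suc (length as) +_) (length-++ (b ∷ bs))))
      where
        σ′ : (b ∷ bs) ++ (c ∷ es) ++ a ∷ as ↭ cs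
        σ′ = ↭-trans (↭-reflexive (≡-sym (++-assoc (b ∷ bs) (c ∷ es) (a ∷ as)))) (↭-trans (++-comm ((b ∷ bs) ++ c ∷ es) (a ∷ as)) σ)
        go : ∀ bs → suc (length (bs ++ c ∷ es)) ≤ 2 → (odd? (length {A = V} (b ∷ bs)) ≡ true → suc (length (es ++ a ∷ as)) ≤ 2) →
             length cs ≢ suc (length as) + (suc (length bs) + suc (length es))
        go (_ ∷ []) (s≤s (s≤s ()))
        go (_ ∷ _ ∷ _) (s≤s (s≤s ()))
        go [] _ f l = 1+n≰n (≤-trans (≤-trans (s≤s (s≤s (s≤s (s≤s z≤n)))) C-length) (≤-trans (≤-reflexive eq) (s≤s (f refl))))
          where
            eq : length cs ≡ suc (suc (length (es ++ a ∷ as)))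
            eq = trans l (trans (+-suc (suc (length as)) (suc (length es))) (cong (λ k → suc (suc k))
                   (trans (+-comm (length as) (suc (length es))) (trans (≡-sym (+-suc (length es) (length as))) (≡-sym (length-++ es {a ∷ as}))))))

    -- The three lengths add up to an odd number, so one of the arcs is odd.
    no-three-arcs : ∀ {v a b c as bs es} → v ∉ cs → v ~ a → v ~ b → v ~ c → a ≢ b → b ≢ c → c ≢ a →
                    Walk a b (a ∷ as) → Walk b c (b ∷ bs) → Walk c a (c ∷ es) → (a ∷ as) ++ (b ∷ bs) ++ c ∷ es ↭ cs → ⊥
    no-three-arcs {v} {a} {b} {c} {as} {bs} {es} v∉ va vb vc a≢b b≢c c≢a w₁ w₂ w₃ σ = pick
        (three-arcs v∉ va vb vc a≢b b≢c w₁ w₂ w₃ σ)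
        (three-arcs v∉ vb vc va b≢c c≢a w₂ w₃ w₁ (rot (a ∷ as) (b ∷ bs) (c ∷ es) σ))
        (three-arcs v∉ vc va vb c≢a a≢b w₃ w₁ w₂ (rot (b ∷ bs) (c ∷ es) (a ∷ as) (rot (a ∷ as) (b ∷ bs) (c ∷ es) σ)))
      where
        rot : ∀ xs ys zs → xs ++ ys ++ zs ↭ cs → ys ++ zs ++ xs ↭ cs
        rot xs ys zs τ = ↭-trans (↭-reflexive (≡-sym (++-assoc ys zs xs))) (↭-trans (++-comm (ys ++ zs) xs) τ)
        total : odd? (length (a ∷ as)) xor (odd? (length (b ∷ bs)) xor odd? (length (c ∷ es))) ≡ true
        total = trans (cong (odd? (length (a ∷ as)) xor_) (trans (≡-sym (odd?-+ (length (b ∷ bs)) _)) (cong odd? (≡-sym (length-++ (b ∷ bs))))))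
                  (trans (≡-sym (odd?-+ (length (a ∷ as)) _)) (trans (cong odd? (split-lengths {a ∷ as} σ)) C-odd))
        pick : odd? (length (a ∷ as)) ≢ true → odd? (length (b ∷ bs)) ≢ true → odd? (length (c ∷ es)) ≢ true → ⊥
        pick p q r = none (odd? (length (a ∷ as))) (odd? (length (b ∷ bs))) (odd? (length (c ∷ es))) p q r total
          where
            none : ∀ x y z → x ≢ true → y ≢ true → z ≢ true → x xor (y xor z) ≢ true
            none true  _ _ p _ _ _ = p refl
            none false true _ _ q _ _ = q refl
            none false false true _ _ r _ = r refl

    no-three-neighbours : ∀ {v} → v ∉ cs → ¬ AtLeast 3 (λ x → v ~ x × x ∈ cs)
    no-three-neighbours {v} v∉ al with atLeast₃ al
    ... | a , b , c , (a≢b , a≢c , b≢c) , (va , a∈) , (vb , b∈) , (vc , c∈) with cycle-split C a∈ b∈ a≢b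
    ... | as , bs , w₁ , w₂ , σ = third w₁ w₂ σ (∈-++⁻ (a ∷ as) (∈-resp-↭ (↭-sym σ) c∈))
      where
        third : ∀ {as bs} → Walk a b (a ∷ as) → Walk b a (b ∷ bs) → (a ∷ as) ++ b ∷ bs ↭ cs → c ∈ a ∷ as ⊎ c ∈ b ∷ bs → ⊥
        third w₁ w₂ σ (inj₁ (here q)) = a≢c (≡-sym q)
        third w₁ w₂ σ (inj₂ (here q)) = b≢c (≡-sym q)
        third (e ∷ʷ w₁) w₂ σ (inj₁ (there m)) with split∈ w₁ m
        ... | splitAt as₁ as₂ u₁ u₂ = no-three-arcs v∉ va vc vb a≢c (b≢c ∘ ≡-sym) (a≢b ∘ ≡-sym) (e ∷ʷ u₁) u₂ w₂
                (↭-trans (↭-reflexive (≡-sym (++-assoc (a ∷ as₁) (c ∷ as₂) _))) σ)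
        third w₁ (e ∷ʷ w₂) σ (inj₂ (there m)) with split∈ w₂ m
        ... | splitAt bs₁ bs₂ u₁ u₂ = no-three-arcs v∉ va vb vc a≢b b≢c (a≢c ∘ ≡-sym) w₁ (e ∷ʷ u₁) u₂ σ

    -- The even arc and the edge `e` form an odd cycle; as C is shortest, the other arc is a single
    -- edge.
    even-chord : ∀ {x y as bs} → y ~ x → Walk x y as → Walk y x (y ∷ bs) → as ++ y ∷ bs ↭ cs →
                 2 ≤ length as → odd? (length as) ≡ false → suc (length bs) ≤ 1
    even-chord {x} {y} {as} {bs} e w w′ σ 2≤ o = +-cancelˡ-≤ (length as) _ _
        (≤-trans (≤-reflexive (split-lengths {as} σ)) (≤-trans (shortest (x , w ++ʷ (e ∷ʷ nil) , uniq , 3≤) odd) (≤-reflexive l)))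
      where
        l : length (as ++ [ y ]) ≡ length as + 1
        l = length-++ as
        l′ : length (as ++ [ y ]) ≡ suc (length as)
        l′ = ≡-sym (↭-length (∷↭∷ʳ y as))
        uniq : Unique (as ++ [ y ])
        uniq = Unique-resp-↭ (∷↭∷ʳ y as) (proj₂ (arc-path as w w′ σ))
        3≤ : 3 ≤ length (as ++ [ y ])
        3≤ = subst (3 ≤_) (≡-sym l′) (s≤s 2≤)
        odd : odd? (length (as ++ [ y ])) ≡ true
        odd = trans (cong odd? l′) (cong not o)

    -- A chord would cut off a shorter odd cycle, so every neighbour on C is next on C.
    leaves-C : ∀ {c} → c ∈ cs → ∃[ y ] c ~ y × y ∉ cs
    leaves-C {c} c∈ with atLeast-split 2 1 (_∈? cs) (degree4 c)
    ... | inj₂ al = atLeast₁ (atLeast-pred al)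
    ... | inj₁ al = ⊥-elim (go (cycle-at C c∈))
      where
        go : ∃[ rest ] Walk c c (c ∷ rest) × c ∷ rest ↭ cs → ⊥
        -- `f` follows `c` on C. Two further neighbours on C would both be the vertex before `c`,
        -- the last one of `rest`.
        go (rest , _∷ʷ_ {y = f} e w , σ) with atLeast₂ (atLeast-∉ f al)
        ... | x , y , x≢y , ((c~x , x∈) , x≢f) , ((c~y , y∈) , y≢f) with last c~x x∈ x≢f | last c~y y∈ y≢f
          where
            last : ∀ {x} → c ~ x → x ∈ cs → x ≢ f → ∃[ as ] rest ≡ as ++ [ x ]
            last {x} c~x x∈ x≢f with ∈-resp-↭ (↭-sym σ) x∈
            ... | here q = ⊥-elim (~⇒≢ c~x (≡-sym q))
            ... | there m = ends w σ (split∈ w m)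
              where
                ends : ∀ {rest} → Walk f c rest → c ∷ rest ↭ cs → SplitAt x f c rest → ∃[ as ] rest ≡ as ++ [ x ]
                ends w σ (splitAt [] bs nil w₂) = ⊥-elim (x≢f refl)
                ends w σ (splitAt as [] w₁ w₂) = as , refl
                ends w σ (splitAt as@(_ ∷ _) bs@(_ ∷ _) w₁ w₂) = ⊥-elim (pick (odd? (length (c ∷ as))) (odd? (length (x ∷ bs))) refl refl
                    (trans (≡-sym (odd?-+ (length (c ∷ as)) _)) (trans (cong odd? (split-lengths {c ∷ as} σ)) C-odd)))
                  where
                    pick : ∀ a b → odd? (length (c ∷ as)) ≡ a → odd? (length (x ∷ bs)) ≡ b → a xor b ≡ true → ⊥
                    pick false true  o _ _ with even-chord (~-sym c~x) (e ∷ʷ w₁) w₂ σ (s≤s (s≤s z≤n)) o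
                    ... | s≤s ()
                    pick true  false _ o _ with even-chord c~x w₂ (e ∷ʷ w₁) (↭-trans (++-comm (x ∷ bs) (c ∷ as)) σ) (s≤s (s≤s z≤n)) o
                    ... | s≤s ()
        ... | as , p | bs , q = x≢y (∷ʳ-injectiveʳ as bs (trans (≡-sym p) q))

    free-neighbours : ∀ {v} → v ∉ cs → AtLeast 2 (λ x → v ~ x × x ∉ cs)
    free-neighbours {v} v∉ with atLeast-split 2 1 (_∈? cs) (degree4 v)
    ... | inj₁ al = ⊥-elim (no-three-neighbours v∉ al)
    ... | inj₂ al = al

    heavy-exists : ¬ ¬ (∃[ v ] v ∉ cs × AtLeast 2 (λ x → v ~ x × x ∈ cs))
    heavy-exists k = minDegree3⇒evenCycle {K = _∉ cs} deg (proj₂ (proj₂ (leaves-C (proj₂ (cycle-vertex C))))) (disjoint-odd-even C C-odd)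
      where
        deg : ∀ {v} → v ∉ cs → AtLeast 3 (λ x → v ~ x × x ∉ cs)
        deg {v} v∉ with atLeast-split 1 2 (_∈? cs) (degree4 v)
        ... | inj₁ al = ⊥-elim (k (_ , v∉ , al))
        ... | inj₂ al = al

    module _ {v c₁ c₂ c₃ c₄ : V} {es : List V} (v∉ : v ∉ cs) (v~c₁ : v ~ c₁) (v~c₃ : v ~ c₃)
      (c₁~c₂ : c₁ ~ c₂) (c₂~c₃ : c₂ ~ c₃) (c₃~c₄ : c₃ ~ c₄)
      (w : Walk c₄ c₁ (c₄ ∷ es)) (σ : c₁ ∷ c₂ ∷ c₃ ∷ c₄ ∷ es ↭ cs) where

      uniq : Unique (c₁ ∷ c₂ ∷ c₃ ∷ c₄ ∷ es)
      uniq = Unique-resp-↭ (↭-sym σ) C-unique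

      c₁₂₃⊆ : ∀ {x} → x ∈ c₁ ∷ c₂ ∷ c₃ ∷ [] → x ∈ cs
      c₁₂₃⊆ m = ∈-resp-↭ σ (∈-++⁺ˡ m)

      fourCycle : CycleOn (v ∷ c₃ ∷ c₁ ∷ c₂ ∷ [])
      fourCycle = apex v~c₁ (~-sym v~c₃) (λ q → unique-∉ uniq (there (here q))) (c₁~c₂ ∷ʷ (c₂~c₃ ∷ʷ nil) ,
          Unique-resp-↭ τ (unique-++ˡ (c₁ ∷ c₂ ∷ c₃ ∷ []) uniq))
        (λ m → v∉ (c₁₂₃⊆ (∈-resp-↭ (↭-sym τ) m)))
        where
          τ : c₁ ∷ c₂ ∷ c₃ ∷ [] ↭ c₃ ∷ c₁ ∷ c₂ ∷ []
          τ = ++-comm (c₁ ∷ c₂ ∷ []) [ c₃ ]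

      -- A component of G - C without `v` would have minimum degree two and so contain a cycle. If
      -- even, this cycle is disjoint from C; if odd, from the 4-cycle through `v`, `c₁`, `c₂`,
      -- `c₃`.
      connected-outside : ∀ {y} → y ∉ cs → ¬ ¬ (∃[ vs ] Walk v y vs × Within (_∉ cs) vs)
      connected-outside {y} y∉ k = minDegree2⇒cycle {K = K} deg (y∉ , [] , nil , within λ ()) no-cycle
        where
          K : V → Set
          K x = x ∉ cs × ∃[ vs ] Walk x y vs × Within (_∉ cs) vs
          deg : ∀ {x} → K x → AtLeast 2 (λ z → x ~ z × K z)
          deg (x∉ , vs , w , i) = atLeast-map
            (λ { (e , z∉) → e , z∉ , _ , ~-sym e ∷ʷ w , within λ { (here refl) → z∉ ; (there m) → at i m } }) (free-neighbours x∉)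
          no-cycle : ¬ (∃[ zs ] Cycle zs × Within K zs)
          no-cycle (zs , Z , i) with odd? (length zs) in o
          ... | false = disjoint-odd-even C C-odd (zs , Z , o , within (proj₁ ∘ at i))
          ... | true  = disjoint-odd-even Z o (even fourCycle)
            where
              outside : ∀ {x} → x ∈ v ∷ c₃ ∷ c₁ ∷ c₂ ∷ [] → x ∉ zs
              outside (here refl) m = k (proj₂ (at i m))
              outside (there m′) m = proj₁ (at i m) (c₁₂₃⊆ (∈-resp-↭ (++-comm [ c₃ ] (c₁ ∷ c₂ ∷ [])) m′))
              even : CycleOn (v ∷ c₃ ∷ c₁ ∷ c₂ ∷ []) → EvenCycleIn (_∉ zs)
              even (ws , c , τ) = ws , c , cong odd? (↭-length τ) , within λ m → outside (∈-resp-↭ τ m)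

      module _ {y : V} {vs : List V} (y∉ : y ∉ cs) (c₄~y : c₄ ~ y) (P : Path v y vs) (P∉ : Within (_∉ cs) vs) where

        close-through : ∀ {t qs} → Path c₄ t qs → Within (_∈ cs) (t ∷ qs) → v ~ t → 1 ≤ length qs →
                        ∃[ ws ] Cycle ws × length ws ≡ 2 + (length vs + length qs)
        close-through {t} {qs} Q i v~t 1≤ = go (snocᵖ P (~-sym c₄~y) c₄∉) (snocᵖ Q (~-sym v~t) (v∉ ∘ at i))
          where
            ∉cs : ∀ {x} → x ∈ y ∷ vs → x ∉ cs
            ∉cs (here refl) = y∉
            ∉cs (there m)   = at P∉ m
            c₄∉ : c₄ ∉ y ∷ vs
            c₄∉ m = ∉cs m (at i (start∈ (proj₁ Q)))
            go : ∃[ ws ] Path v c₄ ws × ws ↭ y ∷ vs → ∃[ rs ] Path c₄ v rs × rs ↭ t ∷ qs →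
                 ∃[ ws ] Cycle ws × length ws ≡ 2 + (length vs + length qs)
            go (ws , W , τ) (rs , R , τ′) = ws ++ rs , close W R (λ { (m , m′) → ∉cs (∈-resp-↭ τ m) (at i (∈-resp-↭ τ′ m′)) })
                (subst (3 ≤_) (≡-sym l) (s≤s (s≤s (≤-trans 1≤ (m≤n+m _ (length vs)))))) , l
              where
                l : length (ws ++ rs) ≡ 2 + (length vs + length qs)
                l = trans (length-++ ws) (trans (cong₂ _+_ (↭-length τ) (↭-length τ′)) (cong suc (+-suc (length vs) (length qs))))

        two-cycles : ∀ {t t′ qs qs′} → Path c₄ t qs → Within (_∈ cs) (t ∷ qs) → v ~ t → 1 ≤ length qs →
                     Path c₄ t′ qs′ → Within (_∈ cs) (t′ ∷ qs′) → v ~ t′ → length qs′ ≡ 2 + length qs →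
                     odd? (length vs + length qs) ≢ true
        two-cycles {qs = qs} {qs′} Q i e 1≤ Q′ i′ e′ l o with close-through Q i e 1≤ | close-through Q′ i′ e′ (subst (1 ≤_) (≡-sym l) (s≤s z≤n))
        ... | ws , c , lw | ws′ , c′ , lw′ = noWin (win c c′ (trans (cong odd? lw) (cong (not ∘ not) o))
              (trans lw′ (cong (2 +_) (trans (cong (length vs +_) l) (trans (+-suc _ _) (trans (cong suc (+-suc _ _)) (≡-sym lw)))))))

        -- Along C, paths from `c₄` to neighbours of `v` have the odd lengths 1 and 3, and the even
        -- lengths |C| - 3 and |C| - 1. The pair whose parity differs from that of the path through
        -- G - C closes up to the two odd cycles.
        contradiction : ⊥
        contradiction = pick (odd? (length vs)) refl
          where
            ρ : c₁ ∷ c₄ ∷ c₃ ∷ c₂ ∷ [] ↭ c₁ ∷ c₂ ∷ c₃ ∷ c₄ ∷ []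
            ρ = prep c₁ (↭-reverse (c₂ ∷ c₃ ∷ c₄ ∷ []))
            ρ′ : c₃ ∷ c₄ ∷ es ++ c₁ ∷ c₂ ∷ [] ↭ c₁ ∷ c₂ ∷ c₃ ∷ c₄ ∷ es
            ρ′ = ++-comm (c₃ ∷ c₄ ∷ es) (c₁ ∷ c₂ ∷ [])
            short : Path c₄ c₃ (c₄ ∷ [])
            short = ~-sym c₃~c₄ ∷ʷ nil , unique-∷ (λ { (here q) → ~⇒≢ c₃~c₄ q }) ([] ∷ [])
            short⁺ : Path c₄ c₁ (c₄ ∷ c₃ ∷ c₂ ∷ [])
            short⁺ = ~-sym c₃~c₄ ∷ʷ (~-sym c₂~c₃ ∷ʷ (~-sym c₁~c₂ ∷ʷ nil)) ,
              Unique-resp-↭ (↭-sym ρ) (unique-++ˡ (c₁ ∷ c₂ ∷ c₃ ∷ c₄ ∷ []) uniq)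
            long : Path c₄ c₁ (c₄ ∷ es)
            long = w , unique-∷ (λ m → unique-∉ uniq (there (there m))) (unique-++ʳ (c₁ ∷ c₂ ∷ c₃ ∷ []) uniq)
            long⁺ : Path c₄ c₃ (c₄ ∷ es ++ c₁ ∷ c₂ ∷ [])
            long⁺ = w ++ʷ (c₁~c₂ ∷ʷ (c₂~c₃ ∷ʷ nil)) , Unique-resp-↭ (↭-sym ρ′) uniq
            in-short⁺ : ∀ {x} → x ∈ c₁ ∷ c₄ ∷ c₃ ∷ c₂ ∷ [] → x ∈ cs
            in-short⁺ m = ∈-resp-↭ σ (∈-++⁺ˡ (∈-resp-↭ ρ m))
            in-short : ∀ {x} → x ∈ c₃ ∷ c₄ ∷ [] → x ∈ cs
            in-short (here q) = in-short⁺ (there (there (here q)))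
            in-short (there (here q)) = in-short⁺ (there (here q))
            in-long : ∀ {x} → x ∈ c₁ ∷ c₄ ∷ es → x ∈ cs
            in-long (here q)  = ∈-resp-↭ σ (here q)
            in-long (there m) = ∈-resp-↭ σ (there (there (there m)))
            l : length (c₄ ∷ es ++ c₁ ∷ c₂ ∷ []) ≡ 2 + length (c₄ ∷ es)
            l = trans (length-++ (c₄ ∷ es)) (+-comm _ 2)
            e-even : odd? (length (c₄ ∷ es)) ≡ false
            e-even = Boolₚ.not-injective (Boolₚ.not-injective (Boolₚ.not-injective (trans (cong odd? (↭-length σ)) C-odd)))
            pick : ∀ b → odd? (length vs) ≡ b → ⊥
            pick false p = two-cycles short (within in-short) v~c₃ (s≤s z≤n) short⁺ (within in-short⁺) v~c₁ refl
              (trans (odd?-+ (length vs) 1) (cong (_xor true) p))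
            pick true  p = two-cycles long (within in-long) v~c₁ (s≤s z≤n) long⁺ (within λ m → ∈-resp-↭ σ (∈-resp-↭ ρ′ m)) v~c₃ l
              (trans (odd?-+ (length vs) (length (c₄ ∷ es))) (cong₂ _xor_ p e-even))

    impossible : ¬ ¬ ⊥
    impossible = do
      v , v∉ , al ← heavy-exists
      let c , c′ , c≢c′ , (v~c , c∈) , (v~c′ , c′∈) = atLeast₂ al
          as , bs , w , w′ , σ = cycle-split C c∈ c′∈ c≢c′
          σ′ = ↭-trans (++-comm (c′ ∷ bs) (c ∷ as)) σ
      [ go v∉ v~c v~c′ w w′ σ , go v∉ v~c′ v~c w′ w σ′ ]′ (even-arc v∉ v~c v~c′ c≢c′ w w′ σ)
      where
        go : ∀ {v c c′ as bs} → v ∉ cs → v ~ c → v ~ c′ → Walk c c′ (c ∷ as) → Walk c′ c (c′ ∷ bs) → (c ∷ as) ++ c′ ∷ bs ↭ cs → length as ≡ 1 → ¬ ¬ ⊥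
        go {as = _ ∷ []} v∉ v~c v~c′ (e ∷ʷ (e′ ∷ʷ nil)) (_ ∷ʷ nil) σ refl =
          ⊥-elim (absurd (≤-trans C-length (≤-reflexive (≡-sym (↭-length σ)))))
          where
            absurd : ¬ 5 ≤ 3
            absurd (s≤s (s≤s (s≤s ())))
        go {as = _ ∷ []} v∉ v~c v~c′ (e ∷ʷ (e′ ∷ʷ nil)) (e″ ∷ʷ w@(_ ∷ʷ _)) σ refl = do
          -- The vertex that follows `c′` on C serves as `c₄`.
          let y , c₄~y , y∉ = leaves-C (∈-resp-↭ σ (there (there (there (here refl)))))
          _ , walk , i ← connected-outside v∉ v~c v~c′ e e′ e″ w σ y∉
          let vs , P , ⊆walk = shorten walk
          λ _ → contradiction v∉ v~c v~c′ e e′ e″ w σ y∉ c₄~y P (within (at i ∘ ⊆walk))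

  -- Descent on the length, bounded by `k`, leads to a shortest odd cycle, to which one of the two
  -- cases applies.
  no-counterexample : ¬ Bipartite G → ¬ ¬ ⊥
  no-counterexample ¬bip = do
      cs , C , o , _ ← ¬bipartite⇒oddCycle κ ¬bip
      go (length cs) C o ≤-refl
    where
      go : ∀ k {cs} → Cycle cs → odd? (length cs) ≡ true → length cs ≤ k → ¬ ¬ ⊥
      go zero (_ , _ , _ , 3≤) _ l with () ← ≤-trans 3≤ l
      go (suc k) {cs} C o l = do
        no ¬shorter ← em {A = ∃[ zs ] Cycle zs × odd? (length zs) ≡ true × length zs < length cs}
          where yes (zs , Z , o′ , l′) → go k Z o′ (≤-pred (≤-trans l′ l))
        let shortest : ∀ {zs} → Cycle zs → odd? (length zs) ≡ true → length cs ≤ length zs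
            shortest Z o′ = ≤-pred (≰⇒> λ l′ → ¬shorter (_ , Z , o′ , l′))
        [ Triangle.impossible C o , (λ 5≤ → Long.impossible C o 5≤ shortest) ]′ (three-or-five (length cs) o (proj₂ (proj₂ (proj₂ C))))
        where
          three-or-five : ∀ l → odd? l ≡ true → 3 ≤ l → l ≡ 3 ⊎ 5 ≤ l
          three-or-five 3 _ _ = inj₁ refl
          three-or-five (suc (suc (suc (suc (suc l))))) _ _ = inj₂ (s≤s (s≤s (s≤s (s≤s (s≤s z≤n)))))
          three-or-five 1 _ (s≤s ())

theorem1p5 : (G : Graph) → KConnected 3 G → ¬ Bipartite G → MinDegreeAtLeast 4 G →
    ∃[ k ] (HasCycle G (2 * k + 1) × HasCycle G (2 * k + 1 + 2))
theorem1p5 G κ ¬bip δ = win⇒HasCycle (decidable-stable win? λ noWin → Counterexample.no-counterexample G κ δ noWin ¬bip id)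
  where
    open ConsecutiveOddCycles G
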